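{- Let $G=(V,E)$ be a finite connected block graph with boundary $\delta\Omega\subseteq V$, and suppose $|\delta\Omega|\ge 2$. Let $L$ be the boundary diameter of $G$, that is, the maximum graph distance in $G$ between two vertices of $\delta\Omega$, and let $B$ be the maximum size of the blocks of $G$. Then the first (non-trivial) Steklov eigenvalue $\lambda_2=\lambda_2(G,\delta\Omega)$ satisfies $$\lambda_2\le\frac{B}{L}.$$
   Context: All graphs are finite, simple and undirected. A block of a graph is a maximal connected subgraph that has no cut vertex of its own (so a single edge $K_2$ may be a block); the size of a block is its number of vertices. A block graph is a connected graph all of whose blocks are complete graphs. The boundary $\delta\Omega$ of a graph $G=(V,E)$ is a chosen non-empty subset of $V$ (not necessarily consisting of leaves). For $f\in\mathbb{R}^V$ put $$R(f)=\frac{\sum_{(x,y)\in E}(f(x)-f(y))^2}{\sum_{x\in\delta\Omega}f(x)^2},$$ where each undirected edge is counted once, with the convention $R(f)=+\infty$ if $f$ vanishes identically on $\delta\Omega$. The Steklov eigenvalues $0=\lambda_1\le\lambda_2\le\cdots\le\lambda_{|\delta\Omega|}$ of $(G,\delta\Omega)$ are $$\lambda_k(G,\delta\Omega)=\min_{W\subset\mathbb{R}^V,\ \dim W=k}\ \max_{0\ne f\in W}R(f),\qquad 1\le k\le|\delta\Omega|,$$ with $W$ ranging over linear subspaces. -}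

module Defs where

open import Level using (0ℓ)
open import Algebra.Bundles using (RawRing)
import Algebra.Definitions.RawMonoid as RawMonoidDefs
open import Data.Bool.Base using (if_then_else_)
open import Data.Fin.Base using (Fin)
import Data.Fin.Properties as Fin
open import Data.Fin.Subset using (Subset; _∈_; _⊆_; ∣_∣; Nonempty)
open import Data.Fin.Subset.Properties using (_∈?_)
open import Data.Nat.Base as ℕ using (ℕ; suc)
import Data.Nat.Properties as ℕ
open import Data.Product.Base using (Σ; ∃; ∃-syntax; Σ-syntax; _×_; _,_; proj₁; proj₂)
open import Data.Rational.Base as ℚ using (ℚ; 0ℚ; 1ℚ; ½)
import Data.Rational.Properties as ℚ
open import Data.Rational.Solver using (module +-*-Solver)
open import Data.Vec.Functional using (Vector)
open import Function.Bundles using (_⇔_)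
open import Relation.Binary.Construct.Closure.ReflexiveTransitive using (Star; fold)
import Relation.Binary.Construct.Add.Supremum.NonStrict as Supremum
open import Relation.Binary.Core using (Rel; _⇒_)
open import Relation.Binary.Definitions using (Decidable; Symmetric; Irreflexive)
open import Relation.Binary.PropositionalEquality
  using (_≡_; _≢_; refl; sym; trans; cong; cong₂; subst)
open import Relation.Nullary.Construct.Add.Supremum using (_⁺; [_]; ⊤⁺)
open import Relation.Nullary.Decidable using (does; _×-dec_)
open import Relation.Nullary.Negation using (¬_)
open import Relation.Unary using (Pred)

-- Real numbers are Cauchy sequences of rationals with pointwise
-- operations; real equality is the setoid equality _≈_.

IsCauchy : (ℕ → ℚ) → Set
IsCauchy x = ∀ ε → 0ℚ ℚ.< ε →
  ∃[ N ] ∀ m n → N ℕ.≤ m → N ℕ.≤ n → ℚ.∣ x m ℚ.- x n ∣ ℚ.≤ ε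

record ℝ : Set where
  constructor mkℝ
  field
    seq    : ℕ → ℚ
    cauchy : IsCauchy seq

open ℝ public

infix 4 _≈_ _≤_

-- Records rather than functions, so that x and y can be inferred.

record _≈_ (x y : ℝ) : Set where
  constructor mk≈
  field
    eventually-≈ : ∀ ε → 0ℚ ℚ.< ε →
      ∃[ N ] ∀ n → N ℕ.≤ n → ℚ.∣ seq x n ℚ.- seq y n ∣ ℚ.≤ ε

record _≤_ (x y : ℝ) : Set where
  constructor mk≤
  field
    eventually-≤ : ∀ ε → 0ℚ ℚ.< ε →
      ∃[ N ] ∀ n → N ℕ.≤ n → seq x n ℚ.≤ seq y n ℚ.+ ε

open _≈_ public
open _≤_ public

private
  abstract
    half>0 : ∀ {ε} → 0ℚ ℚ.< ε → 0ℚ ℚ.< ½ ℚ.* ε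
    half>0 {ε} 0<ε =
      ℚ.positive⁻¹ _ {{ℚ.pos*pos⇒pos ½ ε {{ℚ.positive 0<ε}}}}

    half+half : ∀ ε → ½ ℚ.* ε ℚ.+ ½ ℚ.* ε ≡ ε
    half+half ε = trans (sym (ℚ.*-distribʳ-+ ε ½ ½)) (ℚ.*-identityˡ ε)

    cauchy-const : ∀ q → IsCauchy (λ _ → q)
    cauchy-const q ε 0<ε = 0 , λ _ _ _ _ →
      subst (ℚ._≤ ε) (sym (cong ℚ.∣_∣ (ℚ.+-inverseʳ q))) (ℚ.<⇒≤ 0<ε)

    cauchy-+ : ∀ x y → IsCauchy x → IsCauchy y → IsCauchy (λ n → x n ℚ.+ y n)
    cauchy-+ x y cx cy ε 0<ε =
      let M , hx = cx (½ ℚ.* ε) (half>0 0<ε)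
          N , hy = cy (½ ℚ.* ε) (half>0 0<ε)
      in M ℕ.⊔ N , λ m n p q → begin
      ℚ.∣ (x m ℚ.+ y m) ℚ.- (x n ℚ.+ y n) ∣
        ≡⟨ cong ℚ.∣_∣ (rearrange (x m) (y m) (x n) (y n)) ⟩
      ℚ.∣ (x m ℚ.- x n) ℚ.+ (y m ℚ.- y n) ∣
        ≤⟨ ℚ.∣p+q∣≤∣p∣+∣q∣ (x m ℚ.- x n) (y m ℚ.- y n) ⟩
      ℚ.∣ x m ℚ.- x n ∣ ℚ.+ ℚ.∣ y m ℚ.- y n ∣
        ≤⟨ ℚ.+-mono-≤ (hx m n (ℕ.m⊔n≤o⇒m≤o M N p) (ℕ.m⊔n≤o⇒m≤o M N q))
                      (hy m n (ℕ.m⊔n≤o⇒n≤o M N p) (ℕ.m⊔n≤o⇒n≤o M N q)) ⟩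
      ½ ℚ.* ε ℚ.+ ½ ℚ.* ε
        ≡⟨ half+half ε ⟩
      ε ∎
      where
      open ℚ.≤-Reasoning
      open +-*-Solver
      rearrange : ∀ a b c d →
        (a ℚ.+ b) ℚ.- (c ℚ.+ d) ≡ (a ℚ.- c) ℚ.+ (b ℚ.- d)
      rearrange = solve 4 (λ a b c d →
        (a :+ b) :- (c :+ d) := (a :- c) :+ (b :- d)) refl

    cauchy-neg : ∀ x → IsCauchy x → IsCauchy (λ n → ℚ.- x n)
    cauchy-neg x cx ε 0<ε =
      let N , h = cx ε 0<ε
      in N , λ m n p q → subst (ℚ._≤ ε) (eq (x m) (x n)) (h m n p q)
      where
      open +-*-Solver
      eq : ∀ a b → ℚ.∣ a ℚ.- b ∣ ≡ ℚ.∣ (ℚ.- a) ℚ.- (ℚ.- b) ∣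
      eq a b = trans (sym (ℚ.∣-p∣≡∣p∣ (a ℚ.- b)))
        (cong ℚ.∣_∣ (solve 2 (λ a b → :- (a :- b) := (:- a) :- (:- b)) refl a b))

    cauchy-bounded : ∀ x → IsCauchy x →
      ∃[ b ] ℚ.Positive b × ∃[ N ] ∀ n → N ℕ.≤ n → ℚ.∣ x n ∣ ℚ.≤ b
    cauchy-bounded x cx =
      let N , h = cx 1ℚ (ℚ.positive⁻¹ 1ℚ)
      in 1ℚ ℚ.+ ℚ.∣ x N ∣
      , ℚ.pos+nonNeg⇒pos 1ℚ ℚ.∣ x N ∣ {{ℚ.∣-∣-nonNeg (x N)}}
      , N , λ n p → begin
      ℚ.∣ x n ∣
        ≡⟨ cong ℚ.∣_∣ (solve 2 (λ a b → a := (a :- b) :+ b) refl (x n) (x N)) ⟩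
      ℚ.∣ (x n ℚ.- x N) ℚ.+ x N ∣
        ≤⟨ ℚ.∣p+q∣≤∣p∣+∣q∣ (x n ℚ.- x N) (x N) ⟩
      ℚ.∣ x n ℚ.- x N ∣ ℚ.+ ℚ.∣ x N ∣
        ≤⟨ ℚ.+-monoˡ-≤ ℚ.∣ x N ∣ (h n N p ℕ.≤-refl) ⟩
      1ℚ ℚ.+ ℚ.∣ x N ∣ ∎
      where
      open ℚ.≤-Reasoning
      open +-*-Solver

    *-abs-≤ : ∀ {a b c} p q .{{_ : ℚ.Positive b}} →
      a ≡ p ℚ.* q → ℚ.∣ p ∣ ℚ.≤ b → ℚ.∣ q ∣ ℚ.≤ c → ℚ.∣ a ∣ ℚ.≤ b ℚ.* c
    *-abs-≤ {a} {b} {c} p q a≡pq p≤b q≤c = begin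
      ℚ.∣ a ∣                 ≡⟨ cong ℚ.∣_∣ a≡pq ⟩
      ℚ.∣ p ℚ.* q ∣           ≡⟨ ℚ.∣p*q∣≡∣p∣*∣q∣ p q ⟩
      ℚ.∣ p ∣ ℚ.* ℚ.∣ q ∣
        ≤⟨ ℚ.*-monoʳ-≤-nonNeg ℚ.∣ q ∣ {{ℚ.∣-∣-nonNeg q}} p≤b ⟩
      b ℚ.* ℚ.∣ q ∣
        ≤⟨ ℚ.*-monoˡ-≤-nonNeg b {{ℚ.pos⇒nonNeg b}} q≤c ⟩
      b ℚ.* c ∎
      where open ℚ.≤-Reasoning

    module _ (b : ℚ) {{b>0 : ℚ.Positive b}} where
      private instance
        b≢0 : ℚ.NonZero b
        b≢0 = ℚ.pos⇒nonZero b

      divide>0 : ∀ {ε} → 0ℚ ℚ.< ε → 0ℚ ℚ.< ℚ.1/ b ℚ.* ε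
      divide>0 {ε} 0<ε = ℚ.positive⁻¹ _
        {{ℚ.pos*pos⇒pos (ℚ.1/ b) {{ℚ.1/pos⇒pos b}} ε {{ℚ.positive 0<ε}}}}

      divide-cancel : ∀ ε → b ℚ.* (ℚ.1/ b ℚ.* ε) ≡ ε
      divide-cancel ε = trans (sym (ℚ.*-assoc b (ℚ.1/ b) ε))
        (trans (cong (ℚ._* ε) (ℚ.*-inverseʳ b)) (ℚ.*-identityˡ ε))

      cauchy-tail : ∀ x → IsCauchy x → ∀ ε → 0ℚ ℚ.< ε →
        ∃[ c ] b ℚ.* c ≡ ε × ∃[ N ] ∀ m n → N ℕ.≤ m → N ℕ.≤ n →
          ℚ.∣ x m ℚ.- x n ∣ ℚ.≤ c
      cauchy-tail x cx ε 0<ε =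
        ℚ.1/ b ℚ.* ε , divide-cancel ε , cx (ℚ.1/ b ℚ.* ε) (divide>0 0<ε)

    cauchy-* : ∀ x y → IsCauchy x → IsCauchy y → IsCauchy (λ n → x n ℚ.* y n)
    cauchy-* x y cx cy ε 0<ε =
      let a , a>0 , K , hK = cauchy-bounded x cx
          b , b>0 , L , hL = cauchy-bounded y cy
          c , bc , M , hM = cauchy-tail b {{b>0}} x cx (½ ℚ.* ε) (half>0 0<ε)
          d , ad , N , hN = cauchy-tail a {{a>0}} y cy (½ ℚ.* ε) (half>0 0<ε)
      in (K ℕ.⊔ L) ℕ.⊔ (M ℕ.⊔ N) , λ m n p q →
      let p₁ = ℕ.m⊔n≤o⇒m≤o (K ℕ.⊔ L) (M ℕ.⊔ N) p
          p₂ = ℕ.m⊔n≤o⇒n≤o (K ℕ.⊔ L) (M ℕ.⊔ N) p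
          q₁ = ℕ.m⊔n≤o⇒m≤o (K ℕ.⊔ L) (M ℕ.⊔ N) q
          q₂ = ℕ.m⊔n≤o⇒n≤o (K ℕ.⊔ L) (M ℕ.⊔ N) q
      in begin
      ℚ.∣ x m ℚ.* y m ℚ.- x n ℚ.* y n ∣
        ≡⟨ cong ℚ.∣_∣ (rearrange (x m) (y m) (x n) (y n)) ⟩
      ℚ.∣ y n ℚ.* (x m ℚ.- x n) ℚ.+ x m ℚ.* (y m ℚ.- y n) ∣
        ≤⟨ ℚ.∣p+q∣≤∣p∣+∣q∣ (y n ℚ.* (x m ℚ.- x n)) (x m ℚ.* (y m ℚ.- y n)) ⟩
      ℚ.∣ y n ℚ.* (x m ℚ.- x n) ∣ ℚ.+ ℚ.∣ x m ℚ.* (y m ℚ.- y n) ∣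
        ≤⟨ ℚ.+-mono-≤
             (*-abs-≤ (y n) (x m ℚ.- x n) {{b>0}} refl
               (hL n (ℕ.m⊔n≤o⇒n≤o K L q₁))
               (hM m n (ℕ.m⊔n≤o⇒m≤o M N p₂) (ℕ.m⊔n≤o⇒m≤o M N q₂)))
             (*-abs-≤ (x m) (y m ℚ.- y n) {{a>0}} refl
               (hK m (ℕ.m⊔n≤o⇒m≤o K L p₁))
               (hN m n (ℕ.m⊔n≤o⇒n≤o M N p₂) (ℕ.m⊔n≤o⇒n≤o M N q₂))) ⟩
      b ℚ.* c ℚ.+ a ℚ.* d
        ≡⟨ cong₂ ℚ._+_ bc ad ⟩
      ½ ℚ.* ε ℚ.+ ½ ℚ.* ε
        ≡⟨ half+half ε ⟩
      ε ∎
      where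
      open ℚ.≤-Reasoning
      open +-*-Solver
      rearrange : ∀ s t u v →
        s ℚ.* t ℚ.- u ℚ.* v ≡ v ℚ.* (s ℚ.- u) ℚ.+ s ℚ.* (t ℚ.- v)
      rearrange = solve 4 (λ s t u v →
        s :* t :- u :* v := v :* (s :- u) :+ s :* (t :- v)) refl

infix  8 -_
infixl 7 _*_
infixl 6 _+_ _-_

fromℚ : ℚ → ℝ
fromℚ q .seq _  = q
fromℚ q .cauchy = cauchy-const q

_+_ _*_ : ℝ → ℝ → ℝ

(x + y) .seq n  = seq x n ℚ.+ seq y n
(x + y) .cauchy = cauchy-+ (seq x) (seq y) (cauchy x) (cauchy y)

(x * y) .seq n  = seq x n ℚ.* seq y n
(x * y) .cauchy = cauchy-* (seq x) (seq y) (cauchy x) (cauchy y)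

-_ : ℝ → ℝ
(- x) .seq n  = ℚ.- seq x n
(- x) .cauchy = cauchy-neg (seq x) (cauchy x)

_-_ : ℝ → ℝ → ℝ
x - y = x + (- y)

0ℝ 1ℝ : ℝ
0ℝ = fromℚ 0ℚ
1ℝ = fromℚ 1ℚ

ℝ-rawRing : RawRing 0ℓ 0ℓ
ℝ-rawRing = record
  { _≈_ = _≈_ ; _+_ = _+_ ; _*_ = _*_ ; -_ = -_ ; 0# = 0ℝ ; 1# = 1ℝ }

open RawMonoidDefs (RawRing.+-rawMonoid ℝ-rawRing) public using (sum)

-- ℝ ∪ {+∞}, with ⊤⁺ as +∞.
ℝ∞ : Set
ℝ∞ = ℝ ⁺

open Supremum _≤_ public using () renaming (_≤⁺_ to _≤∞_)

infix 4 _≋_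
_≋_ : ∀ {n} → Rel (Vector ℝ n) 0ℓ
f ≋ g = ∀ i → f i ≈ g i

0ᵥ : ∀ {n} → Vector ℝ n
0ᵥ _ = 0ℝ

record IsSubspace {n} (W : Pred (Vector ℝ n) 0ℓ) : Set where
  field
    resp     : ∀ {f g} → f ≋ g → W f → W g
    0-closed : W 0ᵥ
    +-closed : ∀ {f g} → W f → W g → W (λ i → f i + g i)
    *-closed : ∀ c {f} → W f → W (λ i → c * f i)

combination : ∀ {n k} → Vector ℝ k → Vector (Vector ℝ n) k → Vector ℝ n
combination c b i = sum (λ j → c j * b j i)

LinearlyIndependent : ∀ {n k} → Vector (Vector ℝ n) k → Set
LinearlyIndependent b = ∀ c → combination c b ≋ 0ᵥ → c ≋ 0ᵥ

HasDimension : ∀ {n} → Pred (Vector ℝ n) 0ℓ → ℕ → Set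
HasDimension {n} W k = Σ[ b ∈ Vector (Vector ℝ n) k ]
  LinearlyIndependent b × (∀ f → W f ⇔ (∃[ c ] f ≋ combination c b))

record Graph (n : ℕ) : Set₁ where
  infix 4 _~_
  field
    _~_      : Rel (Fin n) 0ℓ
    _~?_     : Decidable _~_
    ~-sym    : Symmetric _~_
    ~-irrefl : Irreflexive _≡_ _~_

module _ {n : ℕ} (G : Graph n) where
  open Graph G

  Connected : Set
  Connected = ∀ u v → Star _~_ u v

  walkLength : ∀ {u v} → Star _~_ u v → ℕ
  walkLength = fold (λ _ _ → ℕ) (λ _ → suc) 0

  IsDistance : Fin n → Fin n → ℕ → Set
  IsDistance u v d =
    (Σ[ p ∈ Star _~_ u v ] walkLength p ≡ d) × (∀ (p : Star _~_ u v) → d ℕ.≤ walkLength p)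

  IsBoundaryDiameter : Subset n → ℕ → Set
  IsBoundaryDiameter δΩ L =
    (∃[ u ] ∃[ v ] u ∈ δΩ × v ∈ δΩ × IsDistance u v L) ×
    (∀ u v d → u ∈ δΩ → v ∈ δΩ → IsDistance u v d → d ℕ.≤ L)

  -- Not required to be induced.
  record Subgraph : Set₁ where
    field
      vertices : Subset n
      edge     : Rel (Fin n) 0ℓ
      edge?    : Decidable edge
      edge-sym : Symmetric edge
      edge⇒~   : edge ⇒ _~_
      edge⇒∈   : ∀ {u v} → edge u v → u ∈ vertices

  open Subgraph

  _⊑_ : Subgraph → Subgraph → Set
  H ⊑ K = vertices H ⊆ vertices K × edge H ⇒ edge K

  ConnectedSubgraph : Subgraph → Set
  ConnectedSubgraph H = Nonempty (vertices H) ×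
    (∀ {u v} → u ∈ vertices H → v ∈ vertices H → Star (edge H) u v)

  edgeAvoiding : Subgraph → Fin n → Rel (Fin n) 0ℓ
  edgeAvoiding H x u v = u ≢ x × v ≢ x × edge H u v

  -- Deleting x separates two other vertices that were joined in H.
  CutVertex : Subgraph → Fin n → Set
  CutVertex H x = x ∈ vertices H ×
    ∃[ u ] ∃[ v ] u ∈ vertices H × v ∈ vertices H × u ≢ x × v ≢ x ×
      Star (edge H) u v × ¬ Star (edgeAvoiding H x) u v

  ConnectedWithoutCutVertex : Subgraph → Set
  ConnectedWithoutCutVertex H = ConnectedSubgraph H × (∀ x → ¬ CutVertex H x)

  IsBlock : Subgraph → Set₁
  IsBlock H = ConnectedWithoutCutVertex H ×
    (∀ K → ConnectedWithoutCutVertex K → H ⊑ K → K ⊑ H)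

  Complete : Subgraph → Set
  Complete H = ∀ u v → u ∈ vertices H → v ∈ vertices H → u ≢ v → edge H u v

  IsBlockGraph : Set₁
  IsBlockGraph = Connected × (∀ H → IsBlock H → Complete H)

  IsMaxBlockSize : ℕ → Set₁
  IsMaxBlockSize B =
    (Σ[ H ∈ Subgraph ] IsBlock H × ∣ vertices H ∣ ≡ B) ×
    (∀ H → IsBlock H → ∣ vertices H ∣ ℕ.≤ B)

  -- The condition i < j counts each undirected edge once.
  energy : Vector ℝ n → ℝ
  energy f = sum λ i → sum λ j →
    if does ((i Fin.<? j) ×-dec (i ~? j)) then (f i - f j) * (f i - f j) else 0ℝ

  boundaryNorm² : Subset n → Vector ℝ n → ℝ
  boundaryNorm² δΩ f = sum λ x → if does (x ∈? δΩ) then f x * f x else 0ℝ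

  VanishesOn : Subset n → Vector ℝ n → Set
  VanishesOn δΩ f = ∀ x → x ∈ δΩ → f x ≈ 0ℝ

  -- The graph of the function R: equality and vanishing of reals are not
  -- decidable, so R(f) cannot be computed by cases.
  IsRayleighQuotient : Subset n → Vector ℝ n → ℝ∞ → Set
  IsRayleighQuotient δΩ f [ r ] =
    ¬ VanishesOn δΩ f × r * boundaryNorm² δΩ f ≈ energy f
  IsRayleighQuotient δΩ f ⊤⁺    = VanishesOn δΩ f

  -- Maxima and minima are relations (an attained bound): a constructive
  -- definition as real-valued functions would presuppose that they exist.
  IsMaxRayleighQuotient : Subset n → Pred (Vector ℝ n) 0ℓ → ℝ∞ → Set
  IsMaxRayleighQuotient δΩ W m =
    (∃[ f ] W f × ¬ (f ≋ 0ᵥ) × IsRayleighQuotient δΩ f m) ×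
    (∀ f r → W f → ¬ (f ≋ 0ᵥ) → IsRayleighQuotient δΩ f r → r ≤∞ m)

  IsSteklovEigenvalue : Subset n → ℕ → ℝ → Set₁
  IsSteklovEigenvalue δΩ k μ =
    (∃[ W ] IsSubspace W × HasDimension W k × IsMaxRayleighQuotient δΩ W [ μ ]) ×
    (∀ W m → IsSubspace W → HasDimension W k →
       IsMaxRayleighQuotient δΩ W m → [ μ ] ≤∞ m)

{-# OPTIONS --safe #-}

-- Let a = x₀ ~ x₁ ~ ⋯ ~ x_L be a shortest path between two boundary vertices
-- at distance L. An edge xᵢ₋₁xᵢ lies in a unique block, a clique Kᵢ; put
-- cᵢ = −1 on the vertices that Kᵢ sees through xᵢ₋₁, +1 on those it sees
-- through xᵢ, and 0 on the rest. Then h = Σ cᵢ rises by 2L along the path, the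
-- cᵢ change on disjoint sets of edges because Kᵢ and Kⱼ share at most one
-- vertex, and cᵢ has energy 2∣Kᵢ∣, so E(h) ≤ 2LB. After h is centred on the
-- boundary, h and 1 are orthogonal, the maximal Rayleigh quotient on span(1, h)
-- is E(h) / ‖h‖², and ‖h‖² ≥ (2L)² / 2.
--
-- Reachability in a vertex-deleted subgraph is used as if it were decidable:
-- this is harmless because an inequality between reals is stable under double
-- negation.

module Submission where

open import Defs
open import Data.Nat.Base as ℕ using (ℕ; NonZero)
open import Data.Integer.Base using (+_)
open import Data.Rational.Base using (_/_)
open import Data.Fin.Subset using (Subset; ∣_∣)
open import Data.Product.Base using (Σ-syntax)

open import Algebra.Bundles using (CommutativeRing)
open import Data.Bool.Base using (Bool; true; false; if_then_else_)
open import Data.Empty using (⊥; ⊥-elim)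
open import Data.Fin.Base as Fin using (Fin; zero; suc)
open import Data.Fin.Properties as Fin using (_≟_; all?)
open import Data.Fin.Subset using (_∈_; ⁅_⁆)
open import Data.Fin.Subset.Properties using (_∈?_; p⊆q⇒∣p∣≤∣q∣; ∣⁅x⁆∣≡1; x∈⁅x⁆)
import Data.Integer.Base as ℤ
import Data.Integer.Properties as ℤ
open import Data.Nat.Base using (zero; suc)
open import Data.Nat.Induction using (<-wellFounded)
import Data.Nat.Properties as ℕ
open import Data.Product.Base using (∃; ∃-syntax; _×_; _,_; proj₁; proj₂; swap)
open import Data.Rational.Base as ℚ using (ℚ; 0ℚ; 1ℚ; ½)
import Data.Rational.Properties as ℚ
open import Data.Rational.Solver using (module +-*-Solver)
import Data.Rational.Unnormalised.Base as ℚᵘ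
import Data.Rational.Unnormalised.Properties as ℚᵘ
open import Data.Sum.Base using (_⊎_; inj₁; inj₂)
open import Data.Unit.Base using (⊤; tt)
open import Data.Vec.Base using (tabulate)
open import Data.Vec.Functional using (Vector)
open import Data.Vec.Properties using (lookup⇒[]=; []=⇒lookup; lookup∘tabulate)
open import Effect.Monad using (RawMonad)
open import Function.Base using (_∘_; id; case_of_)
open import Function.Bundles using (mk⇔)
open import Induction.WellFounded using (Acc; acc)
open import Level using (0ℓ)
open import Relation.Binary.Construct.Add.Supremum.NonStrict _≤_ using ([_]; [≤]-injective)
open import Relation.Binary.Construct.Closure.ReflexiveTransitive
  using (Star; ε; _◅_; _◅◅_; gmap; reverse; return)
open import Relation.Binary.PropositionalEquality
  using (_≡_; _≢_; refl; sym; trans; cong; cong₂; subst; subst₂; ≢-sym; module ≡-Reasoning)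
open import Relation.Nullary.Construct.Add.Supremum using ([_]; ⊤⁺)
open import Relation.Nullary.Decidable
  using (Dec; yes; no; does; ¬?; _×-dec_; _→-dec_; dec-true; decidable-stable; ¬¬-excluded-middle)
open import Relation.Nullary.Negation using (¬_; contradiction; ¬¬-Monad)
open import Relation.Unary using (Pred)
open import Algebra.Properties.Semiring.Sum (CommutativeRing.semiring ℚ.+-*-commutativeRing)
  using (∑-distrib-+; ∑-comm; *-distribˡ-sum; *-distribʳ-sum; sum-cong-≗)
  renaming (sum to ∑)

-- The shape of cᵢ comes from electrical networks. The effective resistance between two vertices of
-- the complete graph on m vertices is 2/m, and ±1 at the terminals with 0 elsewhere is, up to
-- scale, the potential that attains it: a rise of 2 for an energy of 2m. The cliques then act as
-- resistors in series. A step from 0 to 1 at one vertex of each clique would give only 2(B - 1)/L,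
-- which is weaker once B > 2.
--
-- The minimum defining an eigenvalue can be compared only with subspaces whose maximal quotient is
-- a given attained value, so it is not enough to bound the quotients on span(1, h) from above.
-- Centring removes the cross term and makes the maximum explicit.
--
-- Both basis functions are rational-valued and real arithmetic is pointwise on sequences. Quotients
-- of members with real coefficients are therefore compared in ℚ, index by index, and `rayleigh≤`
-- passes to the limit.

*-pos : ∀ {p q} → 0ℚ ℚ.< p → 0ℚ ℚ.< q → 0ℚ ℚ.< p ℚ.* q
*-pos {p} {q} 0<p 0<q = ℚ.positive⁻¹ (p ℚ.* q)
  {{ℚ.pos*pos⇒pos p {{ℚ.positive 0<p}} q {{ℚ.positive 0<q}}}}

*-nonNeg : ∀ {p q} → 0ℚ ℚ.≤ p → 0ℚ ℚ.≤ q → 0ℚ ℚ.≤ p ℚ.* q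
*-nonNeg {p} {q} 0≤p 0≤q = ℚ.nonNegative⁻¹ (p ℚ.* q)
  {{ℚ.nonNeg*nonNeg⇒nonNeg p {{ℚ.nonNegative 0≤p}} q {{ℚ.nonNegative 0≤q}}}}

+-nonNeg : ∀ {p q} → 0ℚ ℚ.≤ p → 0ℚ ℚ.≤ q → 0ℚ ℚ.≤ p ℚ.+ q
+-nonNeg = ℚ.+-mono-≤ {0ℚ} {_} {0ℚ}

sq : ℚ → ℚ
sq p = p ℚ.* p

sq-nonNeg : ∀ p → 0ℚ ℚ.≤ sq p
sq-nonNeg p with ℚ.≤-total 0ℚ p
... | inj₁ 0≤p = *-nonNeg 0≤p 0≤p
... | inj₂ p≤0 = ℚ.nonNegative⁻¹ (p ℚ.* p)
  {{ℚ.nonPos*nonPos⇒nonPos p {{ℚ.nonPositive p≤0}} p {{ℚ.nonPositive p≤0}}}}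

p≤p+q : ∀ p {q} → 0ℚ ℚ.≤ q → p ℚ.≤ p ℚ.+ q
p≤p+q p {q} 0≤q = subst (ℚ._≤ p ℚ.+ q) (ℚ.+-identityʳ p) (ℚ.+-monoʳ-≤ p 0≤q)

p≤∣p∣ : ∀ p → p ℚ.≤ ℚ.∣ p ∣
p≤∣p∣ p with ℚ.≤-total 0ℚ p
... | inj₁ 0≤p = ℚ.≤-reflexive (sym (ℚ.0≤p⇒∣p∣≡p 0≤p))
... | inj₂ p≤0 = ℚ.≤-trans p≤0 (ℚ.0≤∣p∣ p)

-∣p∣≤p : ∀ p → ℚ.- ℚ.∣ p ∣ ℚ.≤ p
-∣p∣≤p p = subst₂ ℚ._≤_ (cong ℚ.-_ (ℚ.∣-p∣≡∣p∣ p)) (neg-neg p) (ℚ.neg-antimono-≤ (p≤∣p∣ (ℚ.- p)))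
  where
  neg-neg : ∀ p → ℚ.- (ℚ.- p) ≡ p
  neg-neg = solve 1 (λ p → :- (:- p) := p) refl
    where open +-*-Solver

sq-cancel-≤ : ∀ {p δ} → 0ℚ ℚ.< δ → sq p ℚ.≤ sq δ → ℚ.∣ p ∣ ℚ.≤ δ
sq-cancel-≤ {p} {δ} 0<δ p²≤δ² = ℚ.≮⇒≥ λ δ<∣p∣ → ℚ.<-irrefl refl (begin-strict
  sq δ                       <⟨ ℚ.*-monoʳ-<-pos δ {{ℚ.positive 0<δ}} δ<∣p∣ ⟩
  δ ℚ.* ℚ.∣ p ∣               ≤⟨ ℚ.*-monoʳ-≤-nonNeg ℚ.∣ p ∣ {{ℚ.∣-∣-nonNeg p}} (ℚ.<⇒≤ δ<∣p∣) ⟩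
  ℚ.∣ p ∣ ℚ.* ℚ.∣ p ∣         ≡⟨ ℚ.∣p*q∣≡∣p∣*∣q∣ p p ⟨
  ℚ.∣ sq p ∣                 ≡⟨ ℚ.0≤p⇒∣p∣≡p (sq-nonNeg p) ⟩
  sq p                       ≤⟨ p²≤δ² ⟩
  sq δ                       ∎)
  where open ℚ.≤-Reasoning

halve-≤ : ∀ {p q} → p ℚ.+ p ℚ.≤ q ℚ.+ q → p ℚ.≤ q
halve-≤ 2p≤2q = ℚ.≮⇒≥ λ q<p → ℚ.<-irrefl refl (ℚ.≤-<-trans 2p≤2q (ℚ.+-mono-< q<p q<p))

-- Natural numbers as rationals

ι : ℕ → ℚ
ι k = ℤ.+ k / 1

toℚᵘ-/ : ∀ i d .{{_ : NonZero d}} → ℚ.toℚᵘ (i / d) ℚᵘ.≃ i ℚᵘ./ d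
toℚᵘ-/ i (suc d) = ℚ.toℚᵘ-fromℚᵘ (ℚᵘ.mkℚᵘ i d)

ι-suc : ∀ k → ι (suc k) ≡ 1ℚ ℚ.+ ι k
ι-suc k = ℚ.toℚᵘ-injective (begin
  ℚ.toℚᵘ (ι (suc k))                    ≈⟨ toℚᵘ-/ (ℤ.+ suc k) 1 ⟩
  ℤ.+ suc k ℚᵘ./ 1                       ≈⟨ ℚᵘ.*≡* (cong (ℤ._* ℤ.1ℤ) (sym (cong (λ i → ℤ.1ℤ ℤ.+ i) (ℤ.*-identityʳ (ℤ.+ k))))) ⟩
  ℚᵘ.1ℚᵘ ℚᵘ.+ (ℤ.+ k ℚᵘ./ 1)              ≈⟨ ℚᵘ.+-congʳ ℚᵘ.1ℚᵘ (ℚᵘ.≃-sym (toℚᵘ-/ (ℤ.+ k) 1)) ⟩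
  ℚᵘ.1ℚᵘ ℚᵘ.+ ℚ.toℚᵘ (ι k)                ≈⟨ ℚᵘ.≃-sym (ℚ.toℚᵘ-homo-+ 1ℚ (ι k)) ⟩
  ℚ.toℚᵘ (1ℚ ℚ.+ ι k)                    ∎)
  where open ℚᵘ.≃-Reasoning

/-*-cancel : ∀ k l .{{_ : NonZero l}} → (ℤ.+ k / l) ℚ.* ι l ≡ ι k
/-*-cancel k l@(suc _) = ℚ.toℚᵘ-injective (begin
  ℚ.toℚᵘ ((ℤ.+ k / l) ℚ.* ι l)             ≈⟨ ℚ.toℚᵘ-homo-* (ℤ.+ k / l) (ι l) ⟩
  ℚ.toℚᵘ (ℤ.+ k / l) ℚᵘ.* ℚ.toℚᵘ (ι l)     ≈⟨ ℚᵘ.*-cong (toℚᵘ-/ (ℤ.+ k) l) (toℚᵘ-/ (ℤ.+ l) 1) ⟩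
  (ℤ.+ k ℚᵘ./ l) ℚᵘ.* (ℤ.+ l ℚᵘ./ 1)       ≈⟨ ℚᵘ.*≡* (trans (ℤ.*-identityʳ _) (cong (λ i → ℤ.+ k ℤ.* ℤ.+ i) (sym (ℕ.*-identityʳ l)))) ⟩
  ℤ.+ k ℚᵘ./ 1                             ≈⟨ ℚᵘ.≃-sym (toℚᵘ-/ (ℤ.+ k) 1) ⟩
  ℚ.toℚᵘ (ι k)                            ∎)
  where open ℚᵘ.≃-Reasoning

ι-nonNeg : ∀ k → 0ℚ ℚ.≤ ι k
ι-nonNeg zero    = ℚ.≤-refl
ι-nonNeg (suc k) = subst (0ℚ ℚ.≤_) (sym (ι-suc k)) (+-nonNeg (ℚ.nonNegative⁻¹ 1ℚ) (ι-nonNeg k))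

ι-mono : ∀ {k l} → k ℕ.≤ l → ι k ℚ.≤ ι l
ι-mono {l = l} ℕ.z≤n = ι-nonNeg l
ι-mono {suc k} {suc l} (ℕ.s≤s p) =
  subst₂ ℚ._≤_ (sym (ι-suc k)) (sym (ι-suc l)) (ℚ.+-monoʳ-≤ 1ℚ (ι-mono p))

ι-pos : ∀ k .{{_ : NonZero k}} → 0ℚ ℚ.< ι k
ι-pos (suc k) = ℚ.<-≤-trans (ℚ.positive⁻¹ 1ℚ) (ι-mono {1} {suc k} (ℕ.s≤s ℕ.z≤n))

-- Finite sums

∑-mono : ∀ {n} {f g : Fin n → ℚ} → (∀ i → f i ℚ.≤ g i) → ∑ f ℚ.≤ ∑ g
∑-mono {zero}  f≤g = ℚ.≤-refl
∑-mono {suc n} f≤g = ℚ.+-mono-≤ (f≤g zero) (∑-mono (f≤g ∘ suc))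

∑-zero : ∀ n → ∑ {n} (λ _ → 0ℚ) ≡ 0ℚ
∑-zero zero    = refl
∑-zero (suc n) = trans (ℚ.+-identityˡ _) (∑-zero n)

∑-nonNeg : ∀ {n} {f : Fin n → ℚ} → (∀ i → 0ℚ ℚ.≤ f i) → 0ℚ ℚ.≤ ∑ f
∑-nonNeg {n} {f} 0≤f = subst (ℚ._≤ ∑ f) (∑-zero n) (∑-mono 0≤f)

term≤∑ : ∀ {n} {f : Fin n → ℚ} → (∀ i → 0ℚ ℚ.≤ f i) → ∀ i → f i ℚ.≤ ∑ f
term≤∑ {f = f} 0≤f zero = p≤p+q (f zero) (∑-nonNeg (0≤f ∘ suc))
term≤∑ {f = f} 0≤f (suc i) = subst (ℚ._≤ ∑ f) (ℚ.+-identityˡ _)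
  (ℚ.+-mono-≤ (0≤f zero) (term≤∑ (0≤f ∘ suc) i))

two-terms≤∑ : ∀ {n} {f : Fin n → ℚ} → (∀ i → 0ℚ ℚ.≤ f i) →
  ∀ {u v} → u ≢ v → f u ℚ.+ f v ℚ.≤ ∑ f
two-terms≤∑ 0≤f {zero}  {zero}  u≢v = contradiction refl u≢v
two-terms≤∑ {f = f} 0≤f {zero} {suc v} u≢v = ℚ.+-monoʳ-≤ (f zero) (term≤∑ (0≤f ∘ suc) v)
two-terms≤∑ {f = f} 0≤f {suc u} {zero} u≢v = subst (ℚ._≤ ∑ f) (ℚ.+-comm (f zero) (f (suc u)))
  (ℚ.+-monoʳ-≤ (f zero) (term≤∑ (0≤f ∘ suc) u))
two-terms≤∑ {f = f} 0≤f {suc u} {suc v} u≢v = subst (ℚ._≤ ∑ f) (ℚ.+-identityˡ (f (suc u) ℚ.+ f (suc v)))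
  (ℚ.+-mono-≤ (0≤f zero) (two-terms≤∑ (0≤f ∘ suc) (u≢v ∘ cong suc)))

∑-*-∑ : ∀ {m n} (f : Fin m → ℚ) (g : Fin n → ℚ) →
  ∑ (λ i → ∑ (λ j → f i ℚ.* g j)) ≡ ∑ f ℚ.* ∑ g
∑-*-∑ f g = trans (sum-cong-≗ λ i → sym (*-distribˡ-sum (f i) g))
  (sym (*-distribʳ-sum (∑ g) f))

-- Indicator functions and the variance identity

χ : ∀ {a} {A : Set a} → Dec A → ℚ
χ A? = if does A? then 1ℚ else 0ℚ

χ-yes : ∀ {a} {A : Set a} (A? : Dec A) → A → χ A? ≡ 1ℚ
χ-yes (yes _) _ = refl
χ-yes (no ¬a) a = contradiction a ¬a

χ-no : ∀ {a} {A : Set a} (A? : Dec A) → ¬ A → χ A? ≡ 0ℚ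
χ-no (yes a) ¬a = contradiction a ¬a
χ-no (no _)  _  = refl

χ-cong : ∀ {a b} {A : Set a} {B : Set b} (A? : Dec A) (B? : Dec B) →
  (A → B) → (B → A) → χ A? ≡ χ B?
χ-cong (yes a) B? f _ = sym (χ-yes B? (f a))
χ-cong (no ¬a) B? _ g = sym (χ-no B? (¬a ∘ g))

χ-nonNeg : ∀ {a} {A : Set a} (A? : Dec A) → 0ℚ ℚ.≤ χ A?
χ-nonNeg (yes _) = ℚ.nonNegative⁻¹ 1ℚ
χ-nonNeg (no _)  = ℚ.≤-refl

∑-kronecker : ∀ {n} (u : Fin n) (f : Fin n → ℚ) → ∑ (λ i → χ (i ≟ u) ℚ.* f i) ≡ f u
∑-kronecker {suc n} zero f = begin
  1ℚ ℚ.* f zero ℚ.+ ∑ (λ i → 0ℚ ℚ.* f (suc i))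
    ≡⟨ cong₂ ℚ._+_ (ℚ.*-identityˡ (f zero)) (trans (sum-cong-≗ λ i → ℚ.*-zeroˡ (f (suc i))) (∑-zero n)) ⟩
  f zero ℚ.+ 0ℚ ≡⟨ ℚ.+-identityʳ (f zero) ⟩
  f zero ∎
  where open ≡-Reasoning
∑-kronecker {suc n} (suc u) f =
  trans (cong₂ ℚ._+_ (ℚ.*-zeroˡ (f zero)) (∑-kronecker u (f ∘ suc))) (ℚ.+-identityˡ (f (suc u)))

∑-card : ∀ {n} (b : Fin n → Bool) → ∑ (λ i → if b i then 1ℚ else 0ℚ) ≡ ι ∣ tabulate b ∣
∑-card {zero}  b = refl
∑-card {suc n} b with b zero
... | true  = trans (cong (1ℚ ℚ.+_) (∑-card (b ∘ suc))) (sym (ι-suc ∣ tabulate (b ∘ suc) ∣))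
... | false = trans (ℚ.+-identityˡ _) (∑-card (b ∘ suc))

-- The weighted variance identity. With `w` the indicator of a clique, the left side is the energy
-- of `s` on the clique, every edge counted twice.
lagrange : ∀ {n} (w s : Fin n → ℚ) →
  ∑ (λ i → ∑ λ j → w i ℚ.* w j ℚ.* sq (s i ℚ.- s j)) ≡
  (∑ (λ i → w i ℚ.* sq (s i)) ℚ.* ∑ w ℚ.+ ∑ w ℚ.* ∑ (λ i → w i ℚ.* sq (s i))) ℚ.+
  (ℚ.- (1ℚ ℚ.+ 1ℚ)) ℚ.* sq (∑ λ i → w i ℚ.* s i)
lagrange w s = begin
  ∑ (λ i → ∑ λ j → w i ℚ.* w j ℚ.* sq (s i ℚ.- s j))
    ≡⟨ (sum-cong-≗ λ i → sum-cong-≗ λ j → expand (w i) (w j) (s i) (s j)) ⟩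
  ∑ (λ i → ∑ λ j → (ws² i ℚ.* w j ℚ.+ w i ℚ.* ws² j) ℚ.+ (c ℚ.* ws i) ℚ.* ws j)
    ≡⟨ ∑∑-+ (λ i j → ws² i ℚ.* w j ℚ.+ w i ℚ.* ws² j) (λ i j → (c ℚ.* ws i) ℚ.* ws j) ⟩
  ∑ (λ i → ∑ λ j → ws² i ℚ.* w j ℚ.+ w i ℚ.* ws² j) ℚ.+ ∑ (λ i → ∑ λ j → (c ℚ.* ws i) ℚ.* ws j)
    ≡⟨ cong₂ ℚ._+_ (trans (∑∑-+ (λ i j → ws² i ℚ.* w j) (λ i j → w i ℚ.* ws² j)) (cong₂ ℚ._+_ (∑-*-∑ ws² w) (∑-*-∑ w ws²)))
         (trans (∑-*-∑ (λ i → c ℚ.* ws i) ws) (trans (cong (ℚ._* ∑ ws) (sym (*-distribˡ-sum c ws))) (ℚ.*-assoc c (∑ ws) (∑ ws)))) ⟩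
  (∑ ws² ℚ.* ∑ w ℚ.+ ∑ w ℚ.* ∑ ws²) ℚ.+ c ℚ.* sq (∑ ws) ∎
  where
  open ≡-Reasoning
  c = ℚ.- (1ℚ ℚ.+ 1ℚ)
  ws ws² : _ → ℚ
  ws i = w i ℚ.* s i
  ws² i = w i ℚ.* sq (s i)
  ∑∑-+ : ∀ {m n} (f g : Fin m → Fin n → ℚ) →
    ∑ (λ i → ∑ λ j → f i j ℚ.+ g i j) ≡ ∑ (λ i → ∑ λ j → f i j) ℚ.+ ∑ (λ i → ∑ λ j → g i j)
  ∑∑-+ f g = trans (sum-cong-≗ λ i → ∑-distrib-+ (f i) (g i)) (∑-distrib-+ (λ i → ∑ (f i)) (λ i → ∑ (g i)))
  expand : ∀ p q x y → p ℚ.* q ℚ.* sq (x ℚ.- y) ≡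
    (p ℚ.* sq x ℚ.* q ℚ.+ p ℚ.* (q ℚ.* sq y)) ℚ.+ (c ℚ.* (p ℚ.* x)) ℚ.* (q ℚ.* y)
  expand = solve 4 (λ p q x y → p :* q :* ((x :- y) :* (x :- y)) :=
    (p :* (x :* x) :* q :+ p :* (q :* (y :* y))) :+ ((:- (con 1ℚ :+ con 1ℚ)) :* (p :* x)) :* (q :* y)) refl
    where open +-*-Solver

-- Blocks and separation

does-true : ∀ {a} {A : Set a} (A? : Dec A) → does A? ≡ true → A
does-true (yes p) _ = p

module Separation {n} (G : Graph n) where
  open Graph G

  Avoiding : Fin n → Fin n → Fin n → Set
  Avoiding x u v = u ≢ x × v ≢ x × u ~ v

  Joined : Fin n → Fin n → Fin n → Set
  Joined x = Star (Avoiding x)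

  joined-sym : ∀ {x u v} → Joined x u v → Joined x v u
  joined-sym = reverse λ (p , q , e) → q , p , ~-sym e

  ~⇒≢ : ∀ {u v} → u ~ v → u ≢ v
  ~⇒≢ e u≡v = ~-irrefl u≡v e

  ~⇒joined : ∀ {x u v} → u ≢ x → v ≢ x → u ~ v → Joined x u v
  ~⇒joined p q e = return (p , q , e)

  -- `Joined x` is reflexive even at the deleted vertex, so `x` still reaches itself by the empty
  -- walk, but nothing else.
  ¬joined-self : ∀ {x v} → x ≢ v → ¬ Joined x x v
  ¬joined-self x≢v ε = x≢v refl
  ¬joined-self x≢v ((x≢x , _) ◅ _) = x≢x refl

  -- Membership of `z` in the block of the edge ab: no single vertex other than `z` cuts `z` off
  -- from an endpoint that survives the deletion. This describes the block explicitly, with no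
  -- search for a maximal subgraph.
  Inseparable : Fin n → Fin n → Fin n → Set
  Inseparable a b z =
    ∀ x → x ≢ z → (x ≢ a → Joined x z a) × (x ≢ b → Joined x z b)

  -- A `Subgraph` has a Boolean vertex set and a decidable edge relation, so writing the block down
  -- as one requires deciding `Inseparable`.
  module Classical (joined? : ∀ x u v → Dec (Joined x u v)) where

    inseparable? : ∀ a b z → Dec (Inseparable a b z)
    inseparable? a b z = all? λ x → ¬? (x ≟ z) →-dec
      ((¬? (x ≟ a) →-dec joined? x z a) ×-dec (¬? (x ≟ b) →-dec joined? x z b))

    -- The block containing the edge ab.
    block : Fin n → Fin n → Subgraph G
    block a b = record
      { vertices = tabulate λ z → does (inseparable? a b z)
      ; edge     = λ u v → Inseparable a b u × Inseparable a b v × u ~ v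
      ; edge?    = λ u v → inseparable? a b u ×-dec inseparable? a b v ×-dec (u ~? v)
      ; edge-sym = λ (p , q , e) → q , p , ~-sym e
      ; edge⇒~   = λ (_ , _ , e) → e
      ; edge⇒∈   = λ {u} (p , _ , _) → lookup⇒[]= u _
          (trans (lookup∘tabulate _ u) (dec-true (inseparable? a b u) p))
      }

    ∈block⁺ : ∀ {a b z} → Inseparable a b z → z ∈ Subgraph.vertices (block a b)
    ∈block⁺ {a} {b} {z} p = lookup⇒[]= z _
      (trans (lookup∘tabulate _ z) (dec-true (inseparable? a b z) p))

    ∈block⁻ : ∀ {a b z} → z ∈ Subgraph.vertices (block a b) → Inseparable a b z
    ∈block⁻ {a} {b} {z} p =
      does-true (inseparable? a b z) (trans (sym (lookup∘tabulate _ z)) ([]=⇒lookup p))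

    module _ {a b : Fin n} (a~b : a ~ b) where

      endpointˡ : Inseparable a b a
      endpointˡ x x≢a = (λ _ → ε) , λ x≢b → ~⇒joined (≢-sym x≢a) (≢-sym x≢b) a~b

      endpointʳ : Inseparable a b b
      endpointʳ x x≢b = (λ x≢a → ~⇒joined (≢-sym x≢b) (≢-sym x≢a) (~-sym a~b)) , λ _ → ε

      -- The deleted vertex is not both `a` and `b`, so one of the two survives as a meeting point
      -- for walks from `u` and from `v`.
      inseparable-joined : ∀ {x u v} → Inseparable a b u → Inseparable a b v →
        x ≢ u → x ≢ v → Joined x u v
      inseparable-joined {x} hu hv x≢u x≢v with x ≟ a
      ... | no x≢a   = proj₁ (hu x x≢u) x≢a ◅◅ joined-sym (proj₁ (hv x x≢v) x≢a)
      ... | yes refl = proj₂ (hu x x≢u) a≢b ◅◅ joined-sym (proj₂ (hv x x≢v) a≢b)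
        where a≢b = ~⇒≢ a~b

      -- A membership test: for each deleted `x` it is enough to reach some surviving vertex of the
      -- block, and this vertex may depend on `x`.
      inseparable-if : ∀ {z} → (∀ x → x ≢ z → ∃[ y ] Inseparable a b y × x ≢ y × Joined x z y) →
        Inseparable a b z
      inseparable-if h x x≢z = let y , hy , x≢y , z↔y = h x x≢z in
        (λ x≢a → z↔y ◅◅ proj₁ (hy x x≢y) x≢a) , (λ x≢b → z↔y ◅◅ proj₂ (hy x x≢y) x≢b)

      -- Either the walk can be pushed into the block, or it starts outside;
      -- in that case t is the first vertex of the block that it meets, and
      -- the part before t avoids every other vertex of the block.
      Pushed : Fin n → Fin n → Fin n → Set
      Pushed x s v =
        Inseparable a b s × Star (edgeAvoiding G (block a b) x) s v ⊎
        ¬ Inseparable a b s × (∃[ t ] Inseparable a b t ×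
          Star (edgeAvoiding G (block a b) x) t v ×
          (∀ w → Inseparable a b w → w ≢ t → Joined w s t))

      -- Induction on the walk. An excursion that leaves the block at `s` must return at `s`, and is
      -- then cut out; returning at another vertex `t` would put the outside vertex `s'` into the
      -- block.
      push : ∀ {x s v} → Inseparable a b v → Joined x s v → Pushed x s v
      push hv ε = inj₁ (hv , ε)
      push {x} {s} hv (_◅_ {j = s'} (s≢x , s'≢x , e) p)
        with inseparable? a b s | push hv p
      ... | yes hs | inj₁ (hs' , q) = inj₁ (hs , (s≢x , s'≢x , hs , hs' , e) ◅ q)
      ... | no ¬hs | inj₁ (hs' , q) = inj₂ (¬hs , s' , hs' , q , λ w hw w≢s' →
              ~⇒joined (λ { refl → ¬hs hw }) (≢-sym w≢s') e)
      ... | no ¬hs | inj₂ (¬hs' , t , ht , q , out) = inj₂ (¬hs , t , ht , q , λ w hw w≢t →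
              ((λ { refl → ¬hs hw }) , (λ { refl → ¬hs' hw }) , e) ◅ out w hw w≢t)
      ... | yes hs | inj₂ (¬hs' , t , ht , q , out) with s ≟ t
      ...   | yes refl = inj₁ (hs , q)
      ...   | no s≢t   = contradiction (inseparable-if back) ¬hs'
        where
        back : ∀ y → y ≢ s' → ∃[ z ] Inseparable a b z × y ≢ z × Joined y s' z
        back y y≢s' with y ≟ s
        -- Deleting `s` leaves the excursion from `s'` to `t`; any other deletion leaves the edge
        -- from `s'` back to `s`.
        ... | yes refl = t , ht , s≢t , out s hs s≢t
        ... | no y≢s   = s , hs , y≢s , ~⇒joined (≢-sym y≢s') (≢-sym y≢s) (~-sym e)

      joined-inside : ∀ {x u v} → Inseparable a b u → Inseparable a b v →
        x ≢ u → x ≢ v → Star (edgeAvoiding G (block a b) x) u v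
      joined-inside hu hv x≢u x≢v with push hv (inseparable-joined hu hv x≢u x≢v)
      ... | inj₁ (_ , p)   = p
      ... | inj₂ (¬hu , _) = contradiction hu ¬hu

      connected-to-a : ∀ {u} → Inseparable a b u → Star (Subgraph.edge (block a b)) u a
      connected-to-a {u} hu with u ≟ b
      ... | yes refl = return (hu , endpointˡ , ~-sym a~b)
      -- Connectivity is read off from the absence of cut vertices, with `b` as the deleted vertex.
      ... | no u≢b   = gmap id (λ (_ , _ , e) → e)
              (joined-inside hu endpointˡ (≢-sym u≢b) (≢-sym (~⇒≢ a~b)))

      block-connectedWithoutCutVertex : ConnectedWithoutCutVertex G (block a b)
      block-connectedWithoutCutVertex =
        ((a , ∈block⁺ endpointˡ) , λ hu hv →
          connected-to-a (∈block⁻ hu) ◅◅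
          reverse (Subgraph.edge-sym (block a b)) (connected-to-a (∈block⁻ hv))) ,
        λ x (_ , u , v , hu , hv , u≢x , v≢x , _ , ¬p) →
          ¬p (joined-inside (∈block⁻ hu) (∈block⁻ hv) (≢-sym u≢x) (≢-sym v≢x))

      -- For maximality, two vertices of a larger `K` stay joined in G after any deletion: a deleted
      -- vertex of `K` is not a cut vertex, and one outside `K` lies on no walk of `K`. So `K` has
      -- only inseparable vertices, and `block` already contains all edges of G between them.
      block-isBlock : IsBlock G (block a b)
      block-isBlock = block-connectedWithoutCutVertex , maximal
        where
        maximal : ∀ K → ConnectedWithoutCutVertex G K →
          _⊑_ G (block a b) K → _⊑_ G K (block a b)
        maximal K ((_ , conn) , noCut) (V⊆ , _) =
          (λ hz → ∈block⁺ (inside hz)) ,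
          (λ e → inside (edge⇒∈ e) , inside (edge⇒∈ (edge-sym e)) , edge⇒~ e)
          where
          open Subgraph K
          joined : ∀ {x u v} → u ∈ vertices → v ∈ vertices → x ≢ u → x ≢ v → Joined x u v
          joined {x} {u} {v} hu hv x≢u x≢v with x ∈? vertices
          -- Having no cut vertex only refutes the absence of a walk; `joined?` turns this into a
          -- walk.
          ... | yes hx = decidable-stable (joined? x u v) λ ¬j → noCut x
                (hx , u , v , hu , hv , ≢-sym x≢u , ≢-sym x≢v , conn hu hv ,
                 ¬j ∘ gmap id λ (p , q , e) → p , q , edge⇒~ e)
          ... | no x∉  = gmap id
                (λ e → (λ { refl → x∉ (edge⇒∈ e) }) , (λ { refl → x∉ (edge⇒∈ (edge-sym e)) }) , edge⇒~ e)
                (conn hu hv)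
          inside : ∀ {z} → z ∈ vertices → Inseparable a b z
          inside hz x x≢z =
            (λ x≢a → joined hz (V⊆ (∈block⁺ endpointˡ)) x≢z x≢a) ,
            (λ x≢b → joined hz (V⊆ (∈block⁺ endpointʳ)) x≢z x≢b)

-- Energy and the test function

module Dirichlet {n} (G : Graph n) where
  open Graph G

  energyℚ : (Fin n → ℚ) → ℚ
  energyℚ f = ∑ λ i → ∑ λ j →
    if does ((i Fin.<? j) ×-dec (i ~? j)) then (f i ℚ.- f j) ℚ.* (f i ℚ.- f j) else 0ℚ

  -- Every edge is counted in both directions.
  dirichlet : (Fin n → ℚ) → ℚ
  dirichlet f = ∑ λ i → ∑ λ j → χ (i ~? j) ℚ.* sq (f i ℚ.- f j)

  energyℚ-nonNeg : ∀ f → 0ℚ ℚ.≤ energyℚ f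
  energyℚ-nonNeg f = ∑-nonNeg λ i → ∑-nonNeg λ j → term i j
    where
    term : ∀ i j → 0ℚ ℚ.≤ (if does ((i Fin.<? j) ×-dec (i ~? j)) then sq (f i ℚ.- f j) else 0ℚ)
    term i j with does ((i Fin.<? j) ×-dec (i ~? j))
    ... | true  = sq-nonNeg (f i ℚ.- f j)
    ... | false = ℚ.≤-refl

  -- After the second copy is transposed, at most one of `F i j` and `F j i` is nonzero, because i <
  -- j and j < i exclude each other.
  energyℚ+energyℚ≤dirichlet : ∀ f → energyℚ f ℚ.+ energyℚ f ℚ.≤ dirichlet f
  energyℚ+energyℚ≤dirichlet f = begin
    energyℚ f ℚ.+ energyℚ f
      ≡⟨ cong (energyℚ f ℚ.+_) (∑-comm F) ⟩
    energyℚ f ℚ.+ ∑ (λ i → ∑ λ j → F j i)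
      ≡⟨ ∑-distrib-+ (λ i → ∑ (F i)) (λ i → ∑ λ j → F j i) ⟨
    ∑ (λ i → ∑ (F i) ℚ.+ ∑ λ j → F j i)
      ≡⟨ (sum-cong-≗ λ i → ∑-distrib-+ (F i) (λ j → F j i)) ⟨
    ∑ (λ i → ∑ λ j → F i j ℚ.+ F j i)
      ≤⟨ (∑-mono λ i → ∑-mono λ j →
           pair i j (i Fin.<? j) (j Fin.<? i) (i ~? j) (j ~? i)) ⟩
    dirichlet f ∎
    where
    open ℚ.≤-Reasoning
    F : Fin n → Fin n → ℚ
    F i j = if does ((i Fin.<? j) ×-dec (i ~? j)) then sq (f i ℚ.- f j) else 0ℚ
    sq-swap : ∀ p q → sq (p ℚ.- q) ≡ sq (q ℚ.- p)
    sq-swap = solve 2 (λ p q → (p :- q) :* (p :- q) := (q :- p) :* (q :- p)) refl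
      where open +-*-Solver
    pair : ∀ i j (l : Dec (i Fin.< j)) (l′ : Dec (j Fin.< i)) (e : Dec (i ~ j)) (e′ : Dec (j ~ i)) →
      (if does (l ×-dec e) then sq (f i ℚ.- f j) else 0ℚ) ℚ.+
      (if does (l′ ×-dec e′) then sq (f j ℚ.- f i) else 0ℚ) ℚ.≤ χ e ℚ.* sq (f i ℚ.- f j)
    pair i j (yes i<j) (yes j<i) _ _ = contradiction j<i (Fin.<-asym i<j)
    pair i j (yes _) (no _) (yes _) _ = ℚ.≤-reflexive
      (trans (ℚ.+-identityʳ (sq (f i ℚ.- f j))) (sym (ℚ.*-identityˡ (sq (f i ℚ.- f j)))))
    pair i j (yes _) (no _) (no _) _ = ℚ.≤-reflexive (sym (ℚ.*-zeroˡ (sq (f i ℚ.- f j))))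
    pair i j (no _) (yes _) (no ¬e) (yes e′) = contradiction (~-sym e′) ¬e
    pair i j (no _) (yes _) (yes _) (yes _) = ℚ.≤-reflexive
      (trans (ℚ.+-identityˡ (sq (f j ℚ.- f i)))
        (trans (sq-swap (f j) (f i)) (sym (ℚ.*-identityˡ (sq (f i ℚ.- f j))))))
    pair i j (no _) (yes _) e (no _) = *-nonNeg (χ-nonNeg e) (sq-nonNeg (f i ℚ.- f j))
    pair i j (no _) (no _) e _ = *-nonNeg (χ-nonNeg e) (sq-nonNeg (f i ℚ.- f j))

  dirichlet-zero : dirichlet (λ _ → 0ℚ) ≡ 0ℚ
  dirichlet-zero = trans (sum-cong-≗ λ i → trans (sum-cong-≗ λ j → ℚ.*-zeroʳ (χ (i ~? j))) (∑-zero n)) (∑-zero n)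

  -- On each edge at most one of the two increments is nonzero, so there is no cross term.
  dirichlet-+ : ∀ f g → (∀ {y z} → y ~ z → f y ≢ f z → g y ≡ g z) →
    dirichlet (λ x → f x ℚ.+ g x) ≡ dirichlet f ℚ.+ dirichlet g
  dirichlet-+ f g orth = begin
    dirichlet (λ x → f x ℚ.+ g x)
      ≡⟨ (sum-cong-≗ λ i → sum-cong-≗ λ j → term i j) ⟩
    ∑ (λ i → ∑ λ j → F i j ℚ.+ H i j)
      ≡⟨ (sum-cong-≗ λ i → ∑-distrib-+ (F i) (H i)) ⟩
    ∑ (λ i → ∑ (F i) ℚ.+ ∑ (H i))
      ≡⟨ ∑-distrib-+ (λ i → ∑ (F i)) (λ i → ∑ (H i)) ⟩
    dirichlet f ℚ.+ dirichlet g ∎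
    where
    open ≡-Reasoning
    F H : Fin n → Fin n → ℚ
    F i j = χ (i ~? j) ℚ.* sq (f i ℚ.- f j)
    H i j = χ (i ~? j) ℚ.* sq (g i ℚ.- g j)
    f-const : ∀ a b c → 1ℚ ℚ.* sq ((a ℚ.+ b) ℚ.- (a ℚ.+ c)) ≡ 1ℚ ℚ.* sq (a ℚ.- a) ℚ.+ 1ℚ ℚ.* sq (b ℚ.- c)
    f-const = solve 3 (λ a b c → con 1ℚ :* (((a :+ b) :- (a :+ c)) :* ((a :+ b) :- (a :+ c))) :=
      con 1ℚ :* ((a :- a) :* (a :- a)) :+ con 1ℚ :* ((b :- c) :* (b :- c))) refl
      where open +-*-Solver
    g-const : ∀ a b c → 1ℚ ℚ.* sq ((b ℚ.+ a) ℚ.- (c ℚ.+ a)) ≡ 1ℚ ℚ.* sq (b ℚ.- c) ℚ.+ 1ℚ ℚ.* sq (a ℚ.- a)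
    g-const = solve 3 (λ a b c → con 1ℚ :* (((b :+ a) :- (c :+ a)) :* ((b :+ a) :- (c :+ a))) :=
      con 1ℚ :* ((b :- c) :* (b :- c)) :+ con 1ℚ :* ((a :- a) :* (a :- a))) refl
      where open +-*-Solver
    term : ∀ i j → χ (i ~? j) ℚ.* sq ((f i ℚ.+ g i) ℚ.- (f j ℚ.+ g j)) ≡ F i j ℚ.+ H i j
    term i j with i ~? j
    ... | no _ = trans (ℚ.*-zeroˡ (sq ((f i ℚ.+ g i) ℚ.- (f j ℚ.+ g j)))) (sym (cong₂ ℚ._+_ (ℚ.*-zeroˡ (sq (f i ℚ.- f j))) (ℚ.*-zeroˡ (sq (g i ℚ.- g j)))))
    ... | yes e with f i ℚ.≟ f j
    ...   | yes eq rewrite eq = f-const (f j) (g i) (g j)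
    ...   | no neq rewrite orth e neq = g-const (g j) (f i) (f j)

-- The potential of a shortest path in a block graph

module Potential {n} (G : Graph n) (complete : ∀ H → IsBlock G H → Complete G H)
  (joined? : ∀ x u v → Dec (Separation.Joined G x u v)) where
  open Graph G
  open Separation G
  open Classical joined?
  open Dirichlet G

  inseparable-adjacent : ∀ {a b y z} → a ~ b →
    Inseparable a b y → Inseparable a b z → y ≢ z → y ~ z
  inseparable-adjacent {a} {b} {y} {z} a~b hy hz y≢z = Subgraph.edge⇒~ (block a b)
    (complete (block a b) (block-isBlock a~b) y z (∈block⁺ hy) (∈block⁺ hz) y≢z)

  -- After the deletion of one vertex, `y` or `z` survives, and `d` still reaches it because both
  -- lie in the block of cd.
  two-common-vertices : ∀ {a b c d y z} → a ~ b → c ~ d → y ≢ z →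
    Inseparable a b y → Inseparable a b z → Inseparable c d y → Inseparable c d z →
    Inseparable a b d
  two-common-vertices {d = d} {y} {z} a~b c~d y≢z hy hz hy' hz' = inseparable-if a~b route
    where
    route : ∀ x → x ≢ d → ∃[ t ] Inseparable _ _ t × x ≢ t × Joined x d t
    route x x≢d with x ≟ y
    ... | no x≢y   = y , hy , x≢y , inseparable-joined c~d (endpointʳ c~d) hy' x≢d x≢y
    ... | yes refl = z , hz , y≢z , inseparable-joined c~d (endpointʳ c~d) hz' x≢d y≢z

  -- On the block of ab this is −1 at a, 1 at b and 0 elsewhere; every other
  -- vertex takes the value of the block vertex through which it is attached.
  step : Fin n → Fin n → Fin n → ℚ
  step a b z = χ (joined? a z b) ℚ.- χ (joined? b z a)

  module _ {a b : Fin n} (a~b : a ~ b) where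

    private
      a≢b : a ≢ b
      a≢b = ~⇒≢ a~b

    -- Deleting `a` leaves the given walk to `b`; any other deletion leaves the edge to `a`.
    neighbour-inseparable : ∀ {z} → a ~ z → Joined a z b → Inseparable a b z
    neighbour-inseparable {z} a~z z↔b = inseparable-if a~b λ x x≢z → route x x≢z (x ≟ a)
      where
      route : ∀ x → x ≢ z → Dec (x ≡ a) → ∃[ t ] Inseparable a b t × x ≢ t × Joined x z t
      route x x≢z (yes refl) = b , endpointʳ a~b , a≢b , z↔b
      route x x≢z (no x≢a)   = a , endpointˡ a~b , x≢a ,
        ~⇒joined (≢-sym x≢z) (≢-sym x≢a) (~-sym a~z)

    -- An edge missing `a` survives the deletion of `a`, so both its ends reach `b` or neither does.
    -- A change therefore needs an end equal to `a`, where the indicator is 0; the other end reaches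
    -- `b` and is a block vertex by `neighbour-inseparable`.
    reach-changes : ∀ {y z} → y ~ z → χ (joined? a y b) ≢ χ (joined? a z b) →
      Inseparable a b y × Inseparable a b z
    reach-changes {y} {z} y~z neq with y ≟ a | z ≟ a
    ... | yes refl | yes refl = contradiction refl neq
    ... | no y≢a   | no z≢a   = contradiction
          (χ-cong (joined? a y b) (joined? a z b)
            ((z≢a , y≢a , ~-sym y~z) ◅_) ((y≢a , z≢a , y~z) ◅_)) neq
    ... | yes refl | no _ with joined? a z b
    ...   | yes z↔b = endpointˡ a~b , neighbour-inseparable y~z z↔b
    ...   | no _    = contradiction (χ-no (joined? a a b) (¬joined-self a≢b)) neq
    reach-changes {y} {z} y~z neq | no _ | yes refl with joined? a y b
    ...   | yes y↔b = neighbour-inseparable (~-sym y~z) y↔b , endpointˡ a~b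
    ...   | no _    = contradiction (sym (χ-no (joined? a a b) (¬joined-self a≢b))) neq

  module _ {a b : Fin n} (a~b : a ~ b) where

    private
      a≢b : a ≢ b
      a≢b = ~⇒≢ a~b

    step-changes : ∀ {y z} → y ~ z → step a b y ≢ step a b z →
      Inseparable a b y × Inseparable a b z
    step-changes {y} {z} y~z neq with χ (joined? a y b) ℚ.≟ χ (joined? a z b)
    ... | no neq₁  = reach-changes a~b y~z neq₁
    ... | yes eq₁  =
      -- If the first indicator does not change, the second does. It is the first with `a` and `b`
      -- exchanged, which explains the `swap`.
      let hy , hz = reach-changes (~-sym a~b) y~z (neq ∘ cong₂ ℚ._-_ eq₁) in
      (λ x x≢y → swap (hy x x≢y)) , (λ x x≢z → swap (hz x x≢z))

    -- A block vertex other than `a` and `b` reaches each of them past the other, so its two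
    -- indicators cancel.
    step-inside : ∀ {z} → Inseparable a b z → step a b z ≡ χ (z ≟ b) ℚ.- χ (z ≟ a)
    step-inside {z} hz with z ≟ a | z ≟ b
    ... | yes refl | yes refl = contradiction refl a≢b
    ... | yes refl | no _     = cong₂ ℚ._-_ (χ-no (joined? a a b) (¬joined-self a≢b)) (χ-yes (joined? b a a) ε)
    ... | no _     | yes refl = cong₂ ℚ._-_ (χ-yes (joined? a b b) ε) (χ-no (joined? b b a) (¬joined-self (≢-sym a≢b)))
    ... | no z≢a   | no z≢b   = cong₂ ℚ._-_
          (χ-yes (joined? a z b) (proj₂ (hz a (≢-sym z≢a)) a≢b))
          (χ-yes (joined? b z a) (proj₁ (hz b (≢-sym z≢b)) (≢-sym a≢b)))

    step-start : step a b a ≡ ℚ.- 1ℚ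
    step-start = cong₂ ℚ._-_ (χ-no (joined? a a b) (¬joined-self a≢b)) (χ-yes (joined? b a a) ε)

    step-end : step a b b ≡ 1ℚ
    step-end = cong₂ ℚ._-_ (χ-yes (joined? a b b) ε) (χ-no (joined? b b a) (¬joined-self (≢-sym a≢b)))

    -- Edges across which `step a b` changes lie in the block, where it equals `s`. On the block `s`
    -- has first moment 0 and second moment 2, so `lagrange` gives 2 · 2 · ∣K∣; the factor 4
    -- contains the double counting of edges.
    dirichlet-step : dirichlet (step a b) ℚ.≤ ι ∣ Subgraph.vertices (block a b) ∣ ℚ.* ι 4
    dirichlet-step = begin
      dirichlet (step a b)
        ≤⟨ (∑-mono λ y → ∑-mono λ z → term y z) ⟩
      ∑ (λ y → ∑ λ z → w y ℚ.* w z ℚ.* sq (s y ℚ.- s z))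
        ≡⟨ lagrange w s ⟩
      (∑ (λ i → w i ℚ.* sq (s i)) ℚ.* ∑ w ℚ.+ ∑ w ℚ.* ∑ (λ i → w i ℚ.* sq (s i))) ℚ.+
        (ℚ.- (1ℚ ℚ.+ 1ℚ)) ℚ.* sq (∑ λ i → w i ℚ.* s i)
        ≡⟨ cong₂ (λ p q → (p ℚ.* ∑ w ℚ.+ ∑ w ℚ.* p) ℚ.+ (ℚ.- (1ℚ ℚ.+ 1ℚ)) ℚ.* sq q) second-moment first-moment ⟩
      ((1ℚ ℚ.+ 1ℚ) ℚ.* ∑ w ℚ.+ ∑ w ℚ.* (1ℚ ℚ.+ 1ℚ)) ℚ.+ (ℚ.- (1ℚ ℚ.+ 1ℚ)) ℚ.* sq (1ℚ ℚ.- 1ℚ)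
        ≡⟨ collect (∑ w) ⟩
      ∑ w ℚ.* ι 4
        ≡⟨ cong (ℚ._* ι 4) (∑-card (λ z → does (inseparable? a b z))) ⟩
      ι ∣ Subgraph.vertices (block a b) ∣ ℚ.* ι 4 ∎
      where
      open ℚ.≤-Reasoning
      w s : Fin n → ℚ
      w z = χ (inseparable? a b z)
      s z = χ (z ≟ b) ℚ.- χ (z ≟ a)

      collect : ∀ p → ((1ℚ ℚ.+ 1ℚ) ℚ.* p ℚ.+ p ℚ.* (1ℚ ℚ.+ 1ℚ)) ℚ.+ (ℚ.- (1ℚ ℚ.+ 1ℚ)) ℚ.* sq (1ℚ ℚ.- 1ℚ) ≡ p ℚ.* ι 4
      collect = solve 1 (λ p → ((con 1ℚ :+ con 1ℚ) :* p :+ p :* (con 1ℚ :+ con 1ℚ)) :+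
        (:- (con 1ℚ :+ con 1ℚ)) :* ((con 1ℚ :- con 1ℚ) :* (con 1ℚ :- con 1ℚ)) := p :* con (ι 4)) refl
        where open +-*-Solver

      at : ∀ {u} → Inseparable a b u → ∑ (λ z → χ (z ≟ u) ℚ.* w z) ≡ 1ℚ
      at {u} hu = trans (∑-kronecker u w) (χ-yes (inseparable? a b u) hu)

      first-moment : ∑ (λ z → w z ℚ.* s z) ≡ 1ℚ ℚ.- 1ℚ
      first-moment = trans (sum-cong-≗ λ z → split (w z) (χ (z ≟ b)) (χ (z ≟ a)))
        (trans (∑-distrib-+ (λ z → χ (z ≟ b) ℚ.* w z) (λ z → (ℚ.- 1ℚ) ℚ.* (χ (z ≟ a) ℚ.* w z)))
          (cong₂ ℚ._+_ (at (endpointʳ a~b))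
            (trans (sym (*-distribˡ-sum (ℚ.- 1ℚ) (λ z → χ (z ≟ a) ℚ.* w z)))
              (cong ((ℚ.- 1ℚ) ℚ.*_) (at (endpointˡ a~b))))))
        where
        split : ∀ p q r → p ℚ.* (q ℚ.- r) ≡ q ℚ.* p ℚ.+ (ℚ.- 1ℚ) ℚ.* (r ℚ.* p)
        split = solve 3 (λ p q r → p :* (q :- r) := q :* p :+ con (ℚ.- 1ℚ) :* (r :* p)) refl
          where open +-*-Solver

      second-moment : ∑ (λ z → w z ℚ.* sq (s z)) ≡ 1ℚ ℚ.+ 1ℚ
      second-moment = trans (sum-cong-≗ split)
        (trans (∑-distrib-+ (λ z → χ (z ≟ b) ℚ.* w z) (λ z → χ (z ≟ a) ℚ.* w z))
          (cong₂ ℚ._+_ (at (endpointʳ a~b)) (at (endpointˡ a~b))))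
        where
        open +-*-Solver
        split : ∀ z → w z ℚ.* sq (s z) ≡ χ (z ≟ b) ℚ.* w z ℚ.+ χ (z ≟ a) ℚ.* w z
        split z with z ≟ b | z ≟ a
        ... | yes refl | yes refl = contradiction refl a≢b
        ... | yes _ | no _ = solve 1 (λ p → p :* ((con 1ℚ :- con 0ℚ) :* (con 1ℚ :- con 0ℚ)) := con 1ℚ :* p :+ con 0ℚ :* p) refl (w z)
        ... | no _ | yes _ = solve 1 (λ p → p :* ((con 0ℚ :- con 1ℚ) :* (con 0ℚ :- con 1ℚ)) := con 0ℚ :* p :+ con 1ℚ :* p) refl (w z)
        ... | no _ | no _  = solve 1 (λ p → p :* ((con 0ℚ :- con 0ℚ) :* (con 0ℚ :- con 0ℚ)) := con 0ℚ :* p :+ con 0ℚ :* p) refl (w z)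

      0≤rhs : ∀ y z → 0ℚ ℚ.≤ w y ℚ.* w z ℚ.* sq (s y ℚ.- s z)
      0≤rhs y z = *-nonNeg (*-nonNeg (χ-nonNeg (inseparable? a b y)) (χ-nonNeg (inseparable? a b z))) (sq-nonNeg (s y ℚ.- s z))

      term : ∀ y z → χ (y ~? z) ℚ.* sq (step a b y ℚ.- step a b z) ℚ.≤ w y ℚ.* w z ℚ.* sq (s y ℚ.- s z)
      term y z with y ~? z
      ... | no _ = subst (ℚ._≤ w y ℚ.* w z ℚ.* sq (s y ℚ.- s z)) (sym (ℚ.*-zeroˡ (sq (step a b y ℚ.- step a b z)))) (0≤rhs y z)
      ... | yes y~z with step a b y ℚ.≟ step a b z
      ...   | yes eq = subst (ℚ._≤ w y ℚ.* w z ℚ.* sq (s y ℚ.- s z))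
                (sym (trans (cong (λ p → 1ℚ ℚ.* sq (p ℚ.- step a b z)) eq)
                  (cong (λ p → 1ℚ ℚ.* sq p) (ℚ.+-inverseʳ (step a b z))))) (0≤rhs y z)
      ...   | no neq = let hy , hz = step-changes y~z neq in ℚ.≤-reflexive
                (cong₂ ℚ._*_ (sym (cong₂ ℚ._*_ (χ-yes (inseparable? a b y) hy) (χ-yes (inseparable? a b z) hz)))
                  (cong sq (cong₂ ℚ._-_ (step-inside hy) (step-inside hz))))

  -- If both steps changed across yz, the two blocks would share `y` and `z`, so `d` would lie in
  -- the block of ab. Completeness of that block would make `a` adjacent to `d`.
  step-orthogonal : ∀ {a b c d} → a ~ b → c ~ d → a ≢ d → ¬ a ~ d →
    ∀ {y z} → y ~ z → step a b y ≢ step a b z → step c d y ≡ step c d z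
  step-orthogonal {a} {b} {c} {d} a~b c~d a≢d a≁d {y} {z} y~z neq =
    decidable-stable (step c d y ℚ.≟ step c d z) λ neq' →
    let hy , hz   = step-changes a~b y~z neq
        hy' , hz' = step-changes c~d y~z neq'
    in a≁d (inseparable-adjacent a~b (endpointˡ a~b)
         (two-common-vertices a~b c~d (~⇒≢ y~z) hy hz hy' hz') a≢d)

  -- The first vertex of the walk is exempt: in use it is the successor of `a` on the path.
  Far : ∀ {u v} → Fin n → Star _~_ u v → Set
  Far a ε = ⊤
  Far a (_◅_ {j = d} _ p) = a ≢ d × ¬ a ~ d × Far a p

  Induced : ∀ {u v} → Star _~_ u v → Set
  Induced ε = ⊤
  Induced (_◅_ {i = a} _ p) = Far a p × Induced p

  -- If `a` equalled or neighboured a later vertex, jumping there would give a walk from `a` to `v`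
  -- shorter than the assumed minimum.
  shortest-far : ∀ {a u v} (p : Star _~_ u v) →
    (∀ (q : Star _~_ a v) → suc (walkLength G p) ℕ.≤ walkLength G q) → Far a p
  shortest-far ε _ = tt
  shortest-far (_ ◅ p) min =
    (λ { refl → ℕ.n≮n _ (ℕ.<-trans (ℕ.n<1+n _) (min p)) }) ,
    (λ e → ℕ.n≮n _ (min (e ◅ p))) ,
    shortest-far p (λ q → ℕ.<⇒≤ (min q))

  shortest-induced : ∀ {u v} (p : Star _~_ u v) →
    (∀ (q : Star _~_ u v) → walkLength G p ℕ.≤ walkLength G q) → Induced p
  shortest-induced ε _ = tt
  shortest-induced (e ◅ p) min =
    shortest-far p min , shortest-induced p (λ q → ℕ.s≤s⁻¹ (min (e ◅ q)))

  potential : ∀ {u v} → Star _~_ u v → Fin n → ℚ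
  potential ε _ = 0ℚ
  potential (_◅_ {i = a} {j = b} _ p) z = step a b z ℚ.+ potential p z

  -- Serves twice: it makes energies add up in `dirichlet-+`, and applied to the edge ab itself it
  -- shows that the later steps do not change there.
  potential-orthogonal : ∀ {a b u v} (p : Star _~_ u v) → a ~ b → Far a p →
    ∀ {y z} → y ~ z → step a b y ≢ step a b z → potential p y ≡ potential p z
  potential-orthogonal ε _ _ _ _ = refl
  potential-orthogonal (c~d ◅ p) a~b (a≢d , a≁d , far) y~z neq =
    cong₂ ℚ._+_ (step-orthogonal a~b c~d a≢d a≁d y~z neq)
      (potential-orthogonal p a~b far y~z neq)

  -- A change across a later edge cd would put `d` into the block of ab, hence next to `a`.
  step-constant : ∀ {a b u v} (p : Star _~_ u v) → a ~ b → Far a p →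
    step a b u ≡ step a b v
  step-constant ε _ _ = refl
  step-constant {a} {b} (_◅_ {i = c} {j = d} c~d p) a~b (a≢d , a≁d , far) = trans
    (decidable-stable (step a b c ℚ.≟ step a b d) λ neq →
      a≁d (inseparable-adjacent a~b (endpointˡ a~b) (proj₂ (step-changes a~b c~d neq)) a≢d))
    (step-constant p a~b far)

  -- The first step goes from -1 to 1 on its own edge and keeps the value 1 to the end of the path;
  -- the later steps agree at both ends of that edge. Each edge thus contributes exactly 2.
  potential-rise : ∀ {u v} (p : Star _~_ u v) → Induced p →
    potential p v ℚ.- potential p u ≡ ι (walkLength G p) ℚ.* ι 2
  potential-rise ε _ = refl
  potential-rise {u} {v} (_◅_ {j = b} e p) (far , ind) = begin
    (step u b v ℚ.+ potential p v) ℚ.- (step u b u ℚ.+ potential p u)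
      ≡⟨ cong₂ (λ x y → (x ℚ.+ potential p v) ℚ.- (step u b u ℚ.+ y))
           (trans (sym (step-constant p e far)) (step-end e))
           (potential-orthogonal p e far e ends-differ) ⟩
    (1ℚ ℚ.+ potential p v) ℚ.- (step u b u ℚ.+ potential p b)
      ≡⟨ cong (λ x → (1ℚ ℚ.+ potential p v) ℚ.- (x ℚ.+ potential p b)) (step-start e) ⟩
    (1ℚ ℚ.+ potential p v) ℚ.- (ℚ.- 1ℚ ℚ.+ potential p b)
      ≡⟨ regroup (potential p v) (potential p b) ⟩
    ι 2 ℚ.+ (potential p v ℚ.- potential p b)
      ≡⟨ cong (ι 2 ℚ.+_) (potential-rise p ind) ⟩
    ι 2 ℚ.+ ι (walkLength G p) ℚ.* ι 2
      ≡⟨ factor (ι (walkLength G p)) ⟩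
    (1ℚ ℚ.+ ι (walkLength G p)) ℚ.* ι 2
      ≡⟨ cong (ℚ._* ι 2) (ι-suc (walkLength G p)) ⟨
    ι (suc (walkLength G p)) ℚ.* ι 2 ∎
    where
    open ≡-Reasoning
    open +-*-Solver
    ends-differ : step u b u ≢ step u b b
    ends-differ eq = case trans (sym (step-start e)) (trans eq (step-end e)) of λ ()
    regroup : ∀ x y → (1ℚ ℚ.+ x) ℚ.- (ℚ.- 1ℚ ℚ.+ y) ≡ ι 2 ℚ.+ (x ℚ.- y)
    regroup = solve 2 (λ x y → (con 1ℚ :+ x) :- (con (ℚ.- 1ℚ) :+ y) := con (ι 2) :+ (x :- y)) refl
    factor : ∀ x → ι 2 ℚ.+ x ℚ.* ι 2 ≡ (1ℚ ℚ.+ x) ℚ.* ι 2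
    factor = solve 1 (λ x → con (ι 2) :+ x :* con (ι 2) := (con 1ℚ :+ x) :* con (ι 2)) refl

  dirichlet-potential : ∀ {B} → (∀ H → IsBlock G H → ∣ Subgraph.vertices H ∣ ℕ.≤ B) →
    ∀ {u v} (p : Star _~_ u v) → Induced p →
    dirichlet (potential p) ℚ.≤ ι (walkLength G p) ℚ.* (ι B ℚ.* ι 4)
  dirichlet-potential {B} _ ε _ = ℚ.≤-reflexive (trans dirichlet-zero (sym (ℚ.*-zeroˡ (ι B ℚ.* ι 4))))
  dirichlet-potential {B} bound (_◅_ {i = a} {j = b} e p) (far , ind) = begin
    dirichlet (λ z → step a b z ℚ.+ potential p z)
      ≡⟨ dirichlet-+ (step a b) (potential p) (potential-orthogonal p e far) ⟩
    dirichlet (step a b) ℚ.+ dirichlet (potential p)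
      ≤⟨ ℚ.+-mono-≤
           (ℚ.≤-trans (dirichlet-step e)
             (ℚ.*-monoʳ-≤-nonNeg (ι 4) (ι-mono (bound (block a b) (block-isBlock e)))))
           (dirichlet-potential bound p ind) ⟩
    ι B ℚ.* ι 4 ℚ.+ ι (walkLength G p) ℚ.* (ι B ℚ.* ι 4)
      ≡⟨ cong (ℚ._+ ι (walkLength G p) ℚ.* (ι B ℚ.* ι 4)) (sym (ℚ.*-identityˡ (ι B ℚ.* ι 4))) ⟩
    1ℚ ℚ.* (ι B ℚ.* ι 4) ℚ.+ ι (walkLength G p) ℚ.* (ι B ℚ.* ι 4)
      ≡⟨ ℚ.*-distribʳ-+ (ι B ℚ.* ι 4) 1ℚ (ι (walkLength G p)) ⟨
    (1ℚ ℚ.+ ι (walkLength G p)) ℚ.* (ι B ℚ.* ι 4)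
      ≡⟨ cong (ℚ._* (ι B ℚ.* ι 4)) (ι-suc (walkLength G p)) ⟨
    ι (suc (walkLength G p)) ℚ.* (ι B ℚ.* ι 4) ∎
    where open ℚ.≤-Reasoning

-- Null sequences

Eventually : (ℕ → Set) → Set
Eventually P = ∃[ N ] ∀ n → N ℕ.≤ n → P n

eventually₂ : ∀ {P Q R : ℕ → Set} → (∀ n → P n → Q n → R n) →
  Eventually P → Eventually Q → Eventually R
eventually₂ f (M , p) (N , q) = M ℕ.⊔ N , λ n h →
  f n (p n (ℕ.m⊔n≤o⇒m≤o M N h)) (q n (ℕ.m⊔n≤o⇒n≤o M N h))

-- The field of `x ≈ y` is, by definition, `Null` of the difference sequence, so congruence laws
-- reduce to closure properties of null sequences.
Null : (ℕ → ℚ) → Set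
Null u = ∀ δ → 0ℚ ℚ.< δ → Eventually λ n → ℚ.∣ u n ∣ ℚ.≤ δ

½>0 : ∀ {δ} → 0ℚ ℚ.< δ → 0ℚ ℚ.< ½ ℚ.* δ
½>0 = *-pos (ℚ.positive⁻¹ ½)

½+½ : ∀ δ → ½ ℚ.* δ ℚ.+ ½ ℚ.* δ ≡ δ
½+½ = solve 1 (λ δ → con ½ :* δ :+ con ½ :* δ := δ) refl
  where open +-*-Solver

null-resp : ∀ {u v} → (∀ n → u n ≡ v n) → Null u → Null v
null-resp u≡v nu δ 0<δ = let N , h = nu δ 0<δ in
  N , λ n N≤n → subst (λ p → ℚ.∣ p ∣ ℚ.≤ δ) (u≡v n) (h n N≤n)

null-0 : Null λ _ → 0ℚ
null-0 δ 0<δ = 0 , λ _ _ → ℚ.<⇒≤ 0<δ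

null-+ : ∀ {u v} → Null u → Null v → Null λ n → u n ℚ.+ v n
null-+ {u} {v} nu nv δ 0<δ = eventually₂
  (λ n p q → ℚ.≤-trans (ℚ.∣p+q∣≤∣p∣+∣q∣ (u n) (v n))
    (subst (ℚ.∣ u n ∣ ℚ.+ ℚ.∣ v n ∣ ℚ.≤_) (½+½ δ) (ℚ.+-mono-≤ p q)))
  (nu (½ ℚ.* δ) (½>0 0<δ)) (nv (½ ℚ.* δ) (½>0 0<δ))

null-neg : ∀ {u} → Null u → Null λ n → ℚ.- u n
null-neg {u} nu δ 0<δ = let N , h = nu δ 0<δ in
  N , λ n N≤n → subst (ℚ._≤ δ) (sym (ℚ.∣-p∣≡∣p∣ (u n))) (h n N≤n)

bounded : ∀ (x : ℝ) → ∃[ b ] ℚ.Positive b × Eventually λ n → ℚ.∣ seq x n ∣ ℚ.≤ b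
bounded x = let N , h = cauchy x 1ℚ (ℚ.positive⁻¹ 1ℚ) in
  1ℚ ℚ.+ ℚ.∣ seq x N ∣ ,
  ℚ.pos+nonNeg⇒pos 1ℚ ℚ.∣ seq x N ∣ {{ℚ.∣-∣-nonNeg (seq x N)}} ,
  N , λ n N≤n → begin
    ℚ.∣ seq x n ∣                                   ≡⟨ cong ℚ.∣_∣ (recentre (seq x n) (seq x N)) ⟩
    ℚ.∣ (seq x n ℚ.- seq x N) ℚ.+ seq x N ∣         ≤⟨ ℚ.∣p+q∣≤∣p∣+∣q∣ (seq x n ℚ.- seq x N) (seq x N) ⟩
    ℚ.∣ seq x n ℚ.- seq x N ∣ ℚ.+ ℚ.∣ seq x N ∣     ≤⟨ ℚ.+-monoˡ-≤ ℚ.∣ seq x N ∣ (h n N N≤n ℕ.≤-refl) ⟩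
    1ℚ ℚ.+ ℚ.∣ seq x N ∣                            ∎
  where
  open ℚ.≤-Reasoning
  recentre : ∀ p q → p ≡ (p ℚ.- q) ℚ.+ q
  recentre = solve 2 (λ p q → p := (p :- q) :+ q) refl
    where open +-*-Solver

null-* : ∀ (x : ℝ) {u} → Null u → Null λ n → seq x n ℚ.* u n
null-* x {u} nu δ 0<δ = eventually₂ small x≤b
  (nu (ℚ.1/ b ℚ.* δ) (*-pos (ℚ.positive⁻¹ (ℚ.1/ b) {{ℚ.1/pos⇒pos b}}) 0<δ))
  where
  b = proj₁ (bounded x)
  x≤b = proj₂ (proj₂ (bounded x))
  instance
    b>0 : ℚ.Positive b
    b>0 = proj₁ (proj₂ (bounded x))
    b≢0 : ℚ.NonZero b
    b≢0 = ℚ.pos⇒nonZero b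
    b≥0 : ℚ.NonNegative b
    b≥0 = ℚ.pos⇒nonNeg b
  open ℚ.≤-Reasoning
  small : ∀ n → ℚ.∣ seq x n ∣ ℚ.≤ b → ℚ.∣ u n ∣ ℚ.≤ ℚ.1/ b ℚ.* δ → ℚ.∣ seq x n ℚ.* u n ∣ ℚ.≤ δ
  small n p q = begin
    ℚ.∣ seq x n ℚ.* u n ∣             ≡⟨ ℚ.∣p*q∣≡∣p∣*∣q∣ (seq x n) (u n) ⟩
    ℚ.∣ seq x n ∣ ℚ.* ℚ.∣ u n ∣       ≤⟨ ℚ.*-monoʳ-≤-nonNeg ℚ.∣ u n ∣ {{ℚ.∣-∣-nonNeg (u n)}} p ⟩
    b ℚ.* ℚ.∣ u n ∣                   ≤⟨ ℚ.*-monoˡ-≤-nonNeg b q ⟩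
    b ℚ.* (ℚ.1/ b ℚ.* δ)              ≡⟨ ℚ.*-assoc b (ℚ.1/ b) δ ⟨
    (b ℚ.* ℚ.1/ b) ℚ.* δ              ≡⟨ cong (ℚ._* δ) (ℚ.*-inverseʳ b) ⟩
    1ℚ ℚ.* δ                          ≡⟨ ℚ.*-identityˡ δ ⟩
    δ                                 ∎

-- Real arithmetic

≗⇒≈ : ∀ {x y} → (∀ n → seq x n ≡ seq y n) → x ≈ y
≗⇒≈ {x} {y} eq = mk≈ (null-resp
  (λ n → sym (trans (cong (ℚ._- seq y n) (eq n)) (ℚ.+-inverseʳ (seq y n)))) null-0)

≈-refl : ∀ {x} → x ≈ x
≈-refl = ≗⇒≈ λ _ → refl

≈-sym : ∀ {x y} → x ≈ y → y ≈ x
≈-sym {x} {y} p = mk≈ (null-resp (λ n → flip-sub (seq x n) (seq y n)) (null-neg (eventually-≈ p)))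
  where
  flip-sub : ∀ a b → ℚ.- (a ℚ.- b) ≡ b ℚ.- a
  flip-sub = solve 2 (λ a b → :- (a :- b) := b :- a) refl
    where open +-*-Solver

≈-trans : ∀ {x y z} → x ≈ y → y ≈ z → x ≈ z
≈-trans {x} {y} {z} p q = mk≈ (null-resp (λ n → telescope (seq x n) (seq y n) (seq z n))
  (null-+ (eventually-≈ p) (eventually-≈ q)))
  where
  telescope : ∀ a b c → (a ℚ.- b) ℚ.+ (b ℚ.- c) ≡ a ℚ.- c
  telescope = solve 3 (λ a b c → (a :- b) :+ (b :- c) := a :- c) refl
    where open +-*-Solver

+-cong : ∀ {x x′ y y′} → x ≈ x′ → y ≈ y′ → x + y ≈ x′ + y′
+-cong {x} {x′} {y} {y′} p q = mk≈ (null-resp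
  (λ n → regroup (seq x n) (seq x′ n) (seq y n) (seq y′ n)) (null-+ (eventually-≈ p) (eventually-≈ q)))
  where
  regroup : ∀ a b c d → (a ℚ.- b) ℚ.+ (c ℚ.- d) ≡ (a ℚ.+ c) ℚ.- (b ℚ.+ d)
  regroup = solve 4 (λ a b c d → (a :- b) :+ (c :- d) := (a :+ c) :- (b :+ d)) refl
    where open +-*-Solver

-‿cong : ∀ {x y} → x ≈ y → - x ≈ - y
-‿cong {x} {y} p = mk≈ (null-resp (λ n → ℚ.neg-distrib-+ (seq x n) (ℚ.- seq y n)) (null-neg (eventually-≈ p)))

*-cong : ∀ {x x′ y y′} → x ≈ x′ → y ≈ y′ → x * y ≈ x′ * y′
*-cong {x} {x′} {y} {y′} p q = mk≈ (null-resp
  (λ n → regroup (seq x n) (seq x′ n) (seq y n) (seq y′ n))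
  (null-+ (null-* y (eventually-≈ p)) (null-* x′ (eventually-≈ q))))
  where
  regroup : ∀ a b c d → c ℚ.* (a ℚ.- b) ℚ.+ b ℚ.* (c ℚ.- d) ≡ a ℚ.* c ℚ.- b ℚ.* d
  regroup = solve 4 (λ a b c d → c :* (a :- b) :+ b :* (c :- d) := a :* c :- b :* d) refl
    where open +-*-Solver

sum-cong : ∀ {n} {f g : Vector ℝ n} → f ≋ g → sum f ≈ sum g
sum-cong {zero}  _   = ≈-refl
sum-cong {suc n} f≋g = +-cong (f≋g zero) (sum-cong (f≋g ∘ suc))

if-cong : ∀ b {x y z : ℝ} → x ≈ y → (if b then x else z) ≈ (if b then y else z)
if-cong true  p = p
if-cong false _ = ≈-refl

fromℚ-injective : ∀ {p q} → fromℚ p ≈ fromℚ q → p ≡ q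
fromℚ-injective {p} {q} eq = decidable-stable (p ℚ.≟ q) λ p≢q →
  let r , 0<r , r<d = ℚ.<-dense (0<∣p-q∣ p≢q)
      N , h = eventually-≈ eq r 0<r
  in ℚ.<-irrefl refl (ℚ.<-≤-trans r<d (h N ℕ.≤-refl))
  where
  rearrange : ∀ a b → (a ℚ.- b) ℚ.+ b ≡ a
  rearrange = solve 2 (λ a b → (a :- b) :+ b := a) refl
    where open +-*-Solver
  0<∣p-q∣ : p ≢ q → 0ℚ ℚ.< ℚ.∣ p ℚ.- q ∣
  0<∣p-q∣ p≢q = ℚ.≰⇒> λ d≤0 → p≢q (trans (sym (rearrange p q)) (trans
    (cong (ℚ._+ q) (ℚ.∣p∣≡0⇒p≡0 (p ℚ.- q) (ℚ.≤-antisym d≤0 (ℚ.0≤∣p∣ (p ℚ.- q)))))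
    (ℚ.+-identityˡ q)))

≤-trans-fromℚ : ∀ {x p q} → x ≤ fromℚ p → p ℚ.≤ q → x ≤ fromℚ q
≤-trans-fromℚ x≤p p≤q = mk≤ λ δ 0<δ → let N , h = eventually-≤ x≤p δ 0<δ in
  N , λ n N≤n → ℚ.≤-trans (h n N≤n) (ℚ.+-monoˡ-≤ δ p≤q)

-- Constructive strict inequality, with a uniform margin. The order relation `x ≤ fromℚ q` is
-- equivalent to its negation, and this makes it stable under double negation.
Exceeds : ℝ → ℚ → Set
Exceeds x q = ∃[ η ] 0ℚ ℚ.< η × Eventually λ n → q ℚ.+ η ℚ.≤ seq x n

-- One rational comparison at the index `N` decides: with η = δ/4, all later terms lie within η of
-- the `N`-th, so they are either at most q + 3η or at least q + η.
¬exceeds⇒≤ : ∀ {x q} → ¬ Exceeds x q → x ≤ fromℚ q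
¬exceeds⇒≤ {x} {q} ¬exc = mk≤ bound
  where
  module _ (δ : ℚ) (0<δ : 0ℚ ℚ.< δ) where
    open ℚ.≤-Reasoning
    η = ½ ℚ.* (½ ℚ.* δ)
    0<η = ½>0 (½>0 0<δ)
    N = proj₁ (cauchy x η 0<η)
    near : ∀ n → N ℕ.≤ n → ℚ.∣ seq x n ℚ.- seq x N ∣ ℚ.≤ η
    near n N≤n = proj₂ (cauchy x η 0<η) n N N≤n ℕ.≤-refl
    above : ∀ a b → a ≡ (a ℚ.- b) ℚ.+ b
    above = solve 2 (λ a b → a := (a :- b) :+ b) refl
      where open +-*-Solver
    bound : Eventually λ n → seq x n ℚ.≤ q ℚ.+ δ
    bound with seq x N ℚ.≤? q ℚ.+ (η ℚ.+ η)
    ... | yes small = N , λ n N≤n → begin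
      seq x n                                ≡⟨ above (seq x n) (seq x N) ⟩
      (seq x n ℚ.- seq x N) ℚ.+ seq x N      ≤⟨ ℚ.+-mono-≤ (ℚ.≤-trans (p≤∣p∣ (seq x n ℚ.- seq x N)) (near n N≤n)) small ⟩
      η ℚ.+ (q ℚ.+ (η ℚ.+ η))                ≤⟨ p≤p+q (η ℚ.+ (q ℚ.+ (η ℚ.+ η))) (ℚ.<⇒≤ 0<η) ⟩
      (η ℚ.+ (q ℚ.+ (η ℚ.+ η))) ℚ.+ η        ≡⟨ four-quarters q δ ⟩
      q ℚ.+ δ                                ∎
      where
      four-quarters : ∀ q δ → let η = ½ ℚ.* (½ ℚ.* δ) in
        (η ℚ.+ (q ℚ.+ (η ℚ.+ η))) ℚ.+ η ≡ q ℚ.+ δ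
      four-quarters = solve 2 (λ q δ → let η = con ½ :* (con ½ :* δ) in
        (η :+ (q :+ (η :+ η))) :+ η := q :+ δ) refl
        where open +-*-Solver
    ... | no large = ⊥-elim (¬exc (η , 0<η , N , λ n N≤n → begin
      q ℚ.+ η                                                  ≡⟨ cancel q η ⟩
      (q ℚ.+ (η ℚ.+ η)) ℚ.+ ℚ.- η                              ≤⟨ ℚ.+-mono-≤ (ℚ.<⇒≤ (ℚ.≰⇒> large)) (ℚ.neg-antimono-≤ (near n N≤n)) ⟩
      seq x N ℚ.+ ℚ.- ℚ.∣ seq x n ℚ.- seq x N ∣                ≤⟨ ℚ.+-monoʳ-≤ (seq x N) (-∣p∣≤p (seq x n ℚ.- seq x N)) ⟩
      seq x N ℚ.+ (seq x n ℚ.- seq x N)                        ≡⟨ below (seq x n) (seq x N) ⟩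
      seq x n                                                  ∎))
      where
      cancel : ∀ q η → q ℚ.+ η ≡ (q ℚ.+ (η ℚ.+ η)) ℚ.+ ℚ.- η
      cancel = solve 2 (λ q η → q :+ η := (q :+ (η :+ η)) :+ :- η) refl
        where open +-*-Solver
      below : ∀ a b → b ℚ.+ (a ℚ.- b) ≡ a
      below = solve 2 (λ a b → b :+ (a :- b) := a) refl
        where open +-*-Solver

≤⇒¬exceeds : ∀ {x q} → x ≤ fromℚ q → ¬ Exceeds x q
≤⇒¬exceeds {x} {q} x≤q (η , 0<η , exc) =
  let r , 0<r , r<η = ℚ.<-dense 0<η
      N , h = eventually₂ (λ n → ℚ.≤-trans) exc (eventually-≤ x≤q r 0<r)
  in ℚ.<-irrefl refl (ℚ.≤-<-trans (h N ℕ.≤-refl) (ℚ.+-monoʳ-< q r<η))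

-- Rayleigh quotients

seq-sum : ∀ {n} (f : Vector ℝ n) k → seq (sum f) k ≡ ∑ λ i → seq (f i) k
seq-sum {zero}  f k = refl
seq-sum {suc n} f k = cong (seq (f zero) k ℚ.+_) (seq-sum (f ∘ suc) k)

seq-if : ∀ b x y k → seq (if b then x else y) k ≡ (if b then seq x k else seq y k)
seq-if true  x y k = refl
seq-if false x y k = refl

module _ {n} (G : Graph n) (δΩ : Subset n) where
  open Graph G
  open Dirichlet G

  massTerm : (Fin n → ℚ) → Fin n → ℚ
  massTerm f x = if does (x ∈? δΩ) then sq (f x) else 0ℚ

  massℚ : (Fin n → ℚ) → ℚ
  massℚ f = ∑ (massTerm f)

  boundarySum : (Fin n → ℚ) → ℚ
  boundarySum f = ∑ λ x → χ (x ∈? δΩ) ℚ.* f x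

  boundarySize : ℚ
  boundarySize = ∑ λ x → χ (x ∈? δΩ)

  seq-energy : ∀ f k → seq (energy G f) k ≡ energyℚ (λ x → seq (f x) k)
  seq-energy f k = trans (seq-sum (λ i → sum (term i)) k) (sum-cong-≗ λ i →
    trans (seq-sum (term i) k) (sum-cong-≗ λ j →
      seq-if (does ((i Fin.<? j) ×-dec (i ~? j))) ((f i - f j) * (f i - f j)) 0ℝ k))
    where
    term : Fin n → Fin n → ℝ
    term i j = if does ((i Fin.<? j) ×-dec (i ~? j)) then (f i - f j) * (f i - f j) else 0ℝ

  seq-mass : ∀ f k → seq (boundaryNorm² G δΩ f) k ≡ massℚ (λ x → seq (f x) k)
  seq-mass f k = trans (seq-sum (λ x → if does (x ∈? δΩ) then f x * f x else 0ℝ) k) (sum-cong-≗ λ x →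
    seq-if (does (x ∈? δΩ)) (f x * f x) 0ℝ k)

  energy-cong : ∀ {f g} → f ≋ g → energy G f ≈ energy G g
  energy-cong f≋g = sum-cong λ i → sum-cong λ j →
    if-cong (does ((i Fin.<? j) ×-dec (i ~? j)))
      (*-cong (+-cong (f≋g i) (-‿cong (f≋g j))) (+-cong (f≋g i) (-‿cong (f≋g j))))

  mass-cong : ∀ {f g} → f ≋ g → boundaryNorm² G δΩ f ≈ boundaryNorm² G δΩ g
  mass-cong f≋g = sum-cong λ x → if-cong (does (x ∈? δΩ)) (*-cong (f≋g x) (f≋g x))

  massTerm-nonNeg : ∀ f x → 0ℚ ℚ.≤ massTerm f x
  massTerm-nonNeg f x with x ∈? δΩ
  ... | yes _ = sq-nonNeg (f x)
  ... | no _  = ℚ.≤-refl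

  massℚ-nonNeg : ∀ f → 0ℚ ℚ.≤ massℚ f
  massℚ-nonNeg f = ∑-nonNeg {f = massTerm f} (massTerm-nonNeg f)

  massTerm-∈ : ∀ f {x} → x ∈ δΩ → massTerm f x ≡ sq (f x)
  massTerm-∈ f {x} x∈ with x ∈? δΩ
  ... | yes _ = refl
  ... | no x∉ = contradiction x∈ x∉

  sq≤massℚ : ∀ f {x} → x ∈ δΩ → sq (f x) ℚ.≤ massℚ f
  sq≤massℚ f {x} x∈ = subst (ℚ._≤ massℚ f) (massTerm-∈ f x∈) (term≤∑ {f = massTerm f} (massTerm-nonNeg f) x)

  -- The parallelogram law. It depends on `f` only through a difference on the left, so centring
  -- does not spoil the lower bound for the norm.
  sq-difference≤massℚ : ∀ f {u v} → u ∈ δΩ → v ∈ δΩ → u ≢ v →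
    sq (f v ℚ.- f u) ℚ.≤ massℚ f ℚ.+ massℚ f
  sq-difference≤massℚ f {u} {v} u∈ v∈ u≢v = begin
    sq (f v ℚ.- f u)                                        ≤⟨ p≤p+q (sq (f v ℚ.- f u)) (sq-nonNeg (f u ℚ.+ f v)) ⟩
    sq (f v ℚ.- f u) ℚ.+ sq (f u ℚ.+ f v)                   ≡⟨ parallelogram (f u) (f v) ⟩
    (sq (f u) ℚ.+ sq (f v)) ℚ.+ (sq (f u) ℚ.+ sq (f v))     ≤⟨ ℚ.+-mono-≤ both both ⟩
    massℚ f ℚ.+ massℚ f                                     ∎
    where
    open ℚ.≤-Reasoning
    both : sq (f u) ℚ.+ sq (f v) ℚ.≤ massℚ f
    both = subst (ℚ._≤ massℚ f) (cong₂ ℚ._+_ (massTerm-∈ f u∈) (massTerm-∈ f v∈))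
      (two-terms≤∑ {f = massTerm f} (massTerm-nonNeg f) u≢v)
    parallelogram : ∀ a b → sq (b ℚ.- a) ℚ.+ sq (a ℚ.+ b) ≡ (sq a ℚ.+ sq b) ℚ.+ (sq a ℚ.+ sq b)
    parallelogram = solve 2 (λ a b → (b :- a) :* (b :- a) :+ (a :+ b) :* (a :+ b) :=
      (a :* a :+ b :* b) :+ (a :* a :+ b :* b)) refl
      where open +-*-Solver

  null-mass⇒vanishes : ∀ f → Null (λ k → massℚ (λ x → seq (f x) k)) → VanishesOn G δΩ f
  null-mass⇒vanishes f null x x∈ = mk≈ λ δ 0<δ →
    let N , h = null (sq δ) (*-pos 0<δ 0<δ)
    in N , λ k N≤k → subst (λ p → ℚ.∣ p ∣ ℚ.≤ δ) (sym (ℚ.+-identityʳ (seq (f x) k)))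
      (sq-cancel-≤ 0<δ (ℚ.≤-trans (sq≤massℚ (λ y → seq (f y) k) x∈)
        (subst (ℚ._≤ sq δ) (ℚ.0≤p⇒∣p∣≡p (massℚ-nonNeg (λ y → seq (f y) k))) (h k N≤k))))

  -- If r exceeded m by η, then η times the boundary norm of f would tend to 0.
  rayleigh≤ : ∀ {f r m} → (∀ k → energyℚ (λ x → seq (f x) k) ℚ.≤ m ℚ.* massℚ (λ x → seq (f x) k)) →
    ¬ VanishesOn G δΩ f → r * boundaryNorm² G δΩ f ≈ energy G f → r ≤ fromℚ m
  rayleigh≤ {f} {r} {m} E≤mM ¬vanishes rM≈E = ¬exceeds⇒≤ λ (η , 0<η , exc) →
    ¬vanishes (null-mass⇒vanishes f λ δ 0<δ →
      eventually₂ (λ k → small η 0<η δ k) exc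
        -- The tolerance ηδ becomes δ after division by η.
        (eventually-≈ rM≈E (η ℚ.* δ) (*-pos 0<η 0<δ)))
    where
    open ℚ.≤-Reasoning
    small : ∀ η → 0ℚ ℚ.< η → ∀ δ k → m ℚ.+ η ℚ.≤ seq r k →
      ℚ.∣ seq r k ℚ.* seq (boundaryNorm² G δΩ f) k ℚ.- seq (energy G f) k ∣ ℚ.≤ η ℚ.* δ →
      ℚ.∣ massℚ (λ x → seq (f x) k) ∣ ℚ.≤ δ
    small η 0<η δ k m+η≤r close = subst (ℚ._≤ δ) (sym (ℚ.0≤p⇒∣p∣≡p 0≤M))
      (ℚ.*-cancelˡ-≤-pos η {{ℚ.positive 0<η}} (begin
        η ℚ.* M                              ≡⟨ isolate m η M ⟩
        (m ℚ.+ η) ℚ.* M ℚ.- m ℚ.* M          ≤⟨ ℚ.+-mono-≤ (ℚ.*-monoʳ-≤-nonNeg M {{ℚ.nonNegative 0≤M}} m+η≤r)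
                                                  (ℚ.neg-antimono-≤ (E≤mM k)) ⟩
        seq r k ℚ.* M ℚ.- E                  ≤⟨ p≤∣p∣ (seq r k ℚ.* M ℚ.- E) ⟩
        ℚ.∣ seq r k ℚ.* M ℚ.- E ∣            ≤⟨ subst₂ (λ p q → ℚ.∣ seq r k ℚ.* p ℚ.- q ∣ ℚ.≤ η ℚ.* δ) (seq-mass f k) (seq-energy f k) close ⟩
        η ℚ.* δ                              ∎))
      where
      M = massℚ (λ x → seq (f x) k)
      E = energyℚ (λ x → seq (f x) k)
      0≤M = massℚ-nonNeg (λ x → seq (f x) k)
      isolate : ∀ m η M → η ℚ.* M ≡ (m ℚ.+ η) ℚ.* M ℚ.- m ℚ.* M
      isolate = solve 3 (λ m η M → η :* M := (m :+ η) :* M :- m :* M) refl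
        where open +-*-Solver

  centre : boundarySize ≢ 0ℚ → (h : Fin n → ℚ) → ∃[ c ] boundarySum (λ x → h x ℚ.+ c) ≡ 0ℚ
  centre N≢0 h = c , (begin
    boundarySum (λ x → h x ℚ.+ c)
      ≡⟨ (sum-cong-≗ λ x → ℚ.*-distribˡ-+ (χ (x ∈? δΩ)) (h x) c) ⟩
    ∑ (λ x → χ (x ∈? δΩ) ℚ.* h x ℚ.+ χ (x ∈? δΩ) ℚ.* c)
      ≡⟨ ∑-distrib-+ (λ x → χ (x ∈? δΩ) ℚ.* h x) (λ x → χ (x ∈? δΩ) ℚ.* c) ⟩
    S ℚ.+ ∑ (λ x → χ (x ∈? δΩ) ℚ.* c)
      ≡⟨ cong (S ℚ.+_) (*-distribʳ-sum c (λ x → χ (x ∈? δΩ))) ⟨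
    S ℚ.+ N ℚ.* (ℚ.1/ N ℚ.* (ℚ.- S))
      ≡⟨ cong (S ℚ.+_) (trans (sym (ℚ.*-assoc N (ℚ.1/ N) (ℚ.- S))) (trans (cong (ℚ._* (ℚ.- S)) (ℚ.*-inverseʳ N)) (ℚ.*-identityˡ (ℚ.- S)))) ⟩
    S ℚ.+ (ℚ.- S)
      ≡⟨ ℚ.+-inverseʳ S ⟩
    0ℚ ∎)
    where
    open ≡-Reasoning
    N = boundarySize
    S = boundarySum h
    instance
      N-nonZero : ℚ.NonZero N
      N-nonZero = ℚ.≢-nonZero N≢0
    c = ℚ.1/ N ℚ.* (ℚ.- S)

  energyℚ-shift : ∀ h c → energyℚ (λ x → h x ℚ.+ c) ≡ energyℚ h
  energyℚ-shift h c = sum-cong-≗ λ i → sum-cong-≗ λ j →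
    cong (λ p → if does ((i Fin.<? j) ×-dec (i ~? j)) then sq p else 0ℚ) (cancel (h i) (h j) c)
    where
    cancel : ∀ a b c → (a ℚ.+ c) ℚ.- (b ℚ.+ c) ≡ a ℚ.- b
    cancel = solve 3 (λ a b c → (a :+ c) :- (b :+ c) := a :- b) refl
      where open +-*-Solver

  module TestSpace (g : Fin n → ℚ) (centred : boundarySum g ≡ 0ℚ) {u v : Fin n}
    (u∈ : u ∈ δΩ) (v∈ : v ∈ δΩ) (gu≢gv : g u ≢ g v) where

    basis : Vector (Vector ℝ n) 2
    basis zero    _ = 1ℝ
    basis (suc _) x = fromℚ (g x)

    Space : Pred (Vector ℝ n) 0ℓ
    Space f = ∃[ c ] f ≋ combination c basis

    combination-cong : ∀ {c d : Vector ℝ 2} → c ≋ d → combination c basis ≋ combination d basis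
    combination-cong c≋d x = sum-cong λ j → *-cong (c≋d j) (≈-refl {basis j x})

    space-subspace : IsSubspace Space
    space-subspace = record
      { resp     = λ f≋g (c , f≋) → c , λ x → ≈-trans (≈-sym (f≋g x)) (f≋ x)
      ; 0-closed = (λ _ → 0ℝ) , λ x → ≗⇒≈ λ k → zeros (g x)
      ; +-closed = λ (c , f≋) (d , g≋) → (λ j → c j + d j) , λ x →
          ≈-trans (+-cong (f≋ x) (g≋ x)) (≗⇒≈ λ k →
            adds (seq (c zero) k) (seq (c (suc zero)) k) (seq (d zero) k) (seq (d (suc zero)) k) (g x))
      ; *-closed = λ a (c , f≋) → (λ j → a * c j) , λ x →
          ≈-trans (*-cong (≈-refl {a}) (f≋ x)) (≗⇒≈ λ k →
            scales (seq a k) (seq (c zero) k) (seq (c (suc zero)) k) (g x))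
      }
      where
      open +-*-Solver
      zeros : ∀ y → 0ℚ ≡ 0ℚ ℚ.* 1ℚ ℚ.+ (0ℚ ℚ.* y ℚ.+ 0ℚ)
      zeros = solve 1 (λ y → con 0ℚ := con 0ℚ :* con 1ℚ :+ (con 0ℚ :* y :+ con 0ℚ)) refl
      adds : ∀ a b c d y →
        (a ℚ.* 1ℚ ℚ.+ (b ℚ.* y ℚ.+ 0ℚ)) ℚ.+ (c ℚ.* 1ℚ ℚ.+ (d ℚ.* y ℚ.+ 0ℚ)) ≡
        (a ℚ.+ c) ℚ.* 1ℚ ℚ.+ ((b ℚ.+ d) ℚ.* y ℚ.+ 0ℚ)
      adds = solve 5 (λ a b c d y →
        (a :* con 1ℚ :+ (b :* y :+ con 0ℚ)) :+ (c :* con 1ℚ :+ (d :* y :+ con 0ℚ)) :=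
        (a :+ c) :* con 1ℚ :+ ((b :+ d) :* y :+ con 0ℚ)) refl
      scales : ∀ e a b y →
        e ℚ.* (a ℚ.* 1ℚ ℚ.+ (b ℚ.* y ℚ.+ 0ℚ)) ≡ (e ℚ.* a) ℚ.* 1ℚ ℚ.+ ((e ℚ.* b) ℚ.* y ℚ.+ 0ℚ)
      scales = solve 4 (λ e a b y →
        e :* (a :* con 1ℚ :+ (b :* y :+ con 0ℚ)) := (e :* a) :* con 1ℚ :+ ((e :* b) :* y :+ con 0ℚ)) refl

    private
      instance
        slope-nonZero : ℚ.NonZero (g u ℚ.- g v)
        slope-nonZero = ℚ.≢-nonZero {g u ℚ.- g v} λ eq → gu≢gv (trans (sym (restore (g u) (g v)))
          (trans (cong (λ p → p ℚ.+ g v) eq) (ℚ.+-identityˡ (g v))))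
          where
          restore : ∀ a b → (a ℚ.- b) ℚ.+ b ≡ a
          restore = solve 2 (λ a b → (a :- b) :+ b := a) refl
            where open +-*-Solver

    -- Slope and intercept are recovered from the values at `u` and `v`. As these are boundary
    -- vertices, the same argument gives linear independence and `vanishing-member`.
    coefficients-vanish : ∀ c → combination c basis u ≈ 0ℝ → combination c basis v ≈ 0ℝ → c ≋ 0ᵥ
    coefficients-vanish c fu≈0 fv≈0 = λ { zero → c₀≈0 ; (suc zero) → c₁≈0 }
      where
      open +-*-Solver
      s = ℚ.1/ (g u ℚ.- g v)
      slope : ∀ s a b p q → s ℚ.* ((a ℚ.* 1ℚ ℚ.+ (b ℚ.* p ℚ.+ 0ℚ)) ℚ.- (a ℚ.* 1ℚ ℚ.+ (b ℚ.* q ℚ.+ 0ℚ))) ≡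
        b ℚ.* (s ℚ.* (p ℚ.- q))
      slope = solve 5 (λ s a b p q → s :* ((a :* con 1ℚ :+ (b :* p :+ con 0ℚ)) :- (a :* con 1ℚ :+ (b :* q :+ con 0ℚ))) :=
        b :* (s :* (p :- q))) refl
      intercept : ∀ a b p → a ≡ (a ℚ.* 1ℚ ℚ.+ (b ℚ.* p ℚ.+ 0ℚ)) ℚ.- b ℚ.* p
      intercept = solve 3 (λ a b p → a := (a :* con 1ℚ :+ (b :* p :+ con 0ℚ)) :- b :* p) refl
      c₁≈0 : c (suc zero) ≈ 0ℝ
      c₁≈0 = ≈-trans (≗⇒≈ λ k → sym (trans
          (slope s (seq (c zero) k) (seq (c (suc zero)) k) (g u) (g v))
          (trans (cong (seq (c (suc zero)) k ℚ.*_) (ℚ.*-inverseˡ (g u ℚ.- g v))) (ℚ.*-identityʳ (seq (c (suc zero)) k)))))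
        (≈-trans (*-cong (≈-refl {fromℚ s}) (+-cong fu≈0 (-‿cong fv≈0)))
          (≗⇒≈ λ k → ℚ.*-zeroʳ s))
      c₀≈0 : c zero ≈ 0ℝ
      c₀≈0 = ≈-trans (≗⇒≈ λ k → intercept (seq (c zero) k) (seq (c (suc zero)) k) (g u))
        (≈-trans (+-cong fu≈0 (-‿cong (*-cong c₁≈0 (≈-refl {fromℚ (g u)}))))
          (≗⇒≈ λ k → trans (ℚ.+-identityˡ (ℚ.- (0ℚ ℚ.* g u))) (cong ℚ.-_ (ℚ.*-zeroˡ (g u)))))

    space-dimension : HasDimension Space 2
    space-dimension = basis ,
      (λ c c⟨⟩≋0 → coefficients-vanish c (c⟨⟩≋0 u) (c⟨⟩≋0 v)) ,
      λ f → mk⇔ id id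

    -- Excludes the quotient `⊤⁺` for nonzero members of `Space`.
    vanishing-member : ∀ {f} → Space f → VanishesOn G δΩ f → f ≋ 0ᵥ
    vanishing-member (c , f≋) vanishes x = ≈-trans (f≋ x) (≈-trans
      (combination-cong (coefficients-vanish c
        (≈-trans (≈-sym (f≋ u)) (vanishes u u∈)) (≈-trans (≈-sym (f≋ v)) (vanishes v v∈))) x)
      (≈-sym (proj₂ (IsSubspace.0-closed space-subspace) x)))

    -- The argument has the form to which the `k`-th term of `combination c basis x` reduces, with
    -- `a` and `b` the `k`-th terms of the real coefficients.
    energyℚ-affine : ∀ a b → energyℚ (λ x → a ℚ.* 1ℚ ℚ.+ (b ℚ.* g x ℚ.+ 0ℚ)) ≡ sq b ℚ.* energyℚ g
    energyℚ-affine a b = trans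
      (sum-cong-≗ λ i → trans (sum-cong-≗ λ j → term (does ((i Fin.<? j) ×-dec (i ~? j))) (g i) (g j))
        (sym (*-distribˡ-sum (sq b) (λ j → E i j))))
      (sym (*-distribˡ-sum (sq b) (λ i → ∑ (E i))))
      where
      E : Fin n → Fin n → ℚ
      E i j = if does ((i Fin.<? j) ×-dec (i ~? j)) then sq (g i ℚ.- g j) else 0ℚ
      term : ∀ t p q →
        (if t then sq ((a ℚ.* 1ℚ ℚ.+ (b ℚ.* p ℚ.+ 0ℚ)) ℚ.- (a ℚ.* 1ℚ ℚ.+ (b ℚ.* q ℚ.+ 0ℚ))) else 0ℚ) ≡
        sq b ℚ.* (if t then sq (p ℚ.- q) else 0ℚ)
      term false p q = sym (ℚ.*-zeroʳ (sq b))
      term true  p q = solve 4 (λ a b p q → let d = (a :* con 1ℚ :+ (b :* p :+ con 0ℚ)) :- (a :* con 1ℚ :+ (b :* q :+ con 0ℚ)) in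
        d :* d := (b :* b) :* ((p :- q) :* (p :- q))) refl a b p q
        where open +-*-Solver

    -- The cross term vanishes because g has mean zero on the boundary.
    massℚ-affine : ∀ a b → massℚ (λ x → a ℚ.* 1ℚ ℚ.+ (b ℚ.* g x ℚ.+ 0ℚ)) ≡
      sq a ℚ.* boundarySize ℚ.+ sq b ℚ.* massℚ g
    massℚ-affine a b = begin
      massℚ (λ x → a ℚ.* 1ℚ ℚ.+ (b ℚ.* g x ℚ.+ 0ℚ))
        ≡⟨ (sum-cong-≗ λ x → term (x ∈? δΩ) (g x)) ⟩
      ∑ (λ x → sq a ℚ.* w x ℚ.+ (c ℚ.* (w x ℚ.* g x) ℚ.+ sq b ℚ.* m x))
        ≡⟨ ∑-distrib-+ (λ x → sq a ℚ.* w x) (λ x → c ℚ.* (w x ℚ.* g x) ℚ.+ sq b ℚ.* m x) ⟩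
      ∑ (λ x → sq a ℚ.* w x) ℚ.+ ∑ (λ x → c ℚ.* (w x ℚ.* g x) ℚ.+ sq b ℚ.* m x)
        ≡⟨ cong₂ ℚ._+_ (sym (*-distribˡ-sum (sq a) w))
             (trans (∑-distrib-+ (λ x → c ℚ.* (w x ℚ.* g x)) (λ x → sq b ℚ.* m x))
               (cong₂ ℚ._+_ (trans (sym (*-distribˡ-sum c (λ x → w x ℚ.* g x))) (cong (c ℚ.*_) centred))
                 (sym (*-distribˡ-sum (sq b) m)))) ⟩
      sq a ℚ.* boundarySize ℚ.+ (c ℚ.* 0ℚ ℚ.+ sq b ℚ.* massℚ g)
        ≡⟨ cong (sq a ℚ.* boundarySize ℚ.+_) (trans (cong (ℚ._+ sq b ℚ.* massℚ g) (ℚ.*-zeroʳ c)) (ℚ.+-identityˡ (sq b ℚ.* massℚ g))) ⟩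
      sq a ℚ.* boundarySize ℚ.+ sq b ℚ.* massℚ g ∎
      where
      open ≡-Reasoning
      c = (1ℚ ℚ.+ 1ℚ) ℚ.* (a ℚ.* b)
      w m : Fin n → ℚ
      w x = χ (x ∈? δΩ)
      m = massTerm g
      term : ∀ {A : Set} (t : Dec A) y →
        (if does t then sq (a ℚ.* 1ℚ ℚ.+ (b ℚ.* y ℚ.+ 0ℚ)) else 0ℚ) ≡
        sq a ℚ.* χ t ℚ.+ (c ℚ.* (χ t ℚ.* y) ℚ.+ sq b ℚ.* (if does t then sq y else 0ℚ))
      term (yes _) y = solve 3 (λ a b y → let d = a :* con 1ℚ :+ (b :* y :+ con 0ℚ) in
        d :* d := (a :* a) :* con 1ℚ :+ (((con 1ℚ :+ con 1ℚ) :* (a :* b)) :* (con 1ℚ :* y) :+ (b :* b) :* (y :* y))) refl a b y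
        where open +-*-Solver
      term (no _) y = solve 3 (λ a b y →
        con 0ℚ := (a :* a) :* con 0ℚ :+ (((con 1ℚ :+ con 1ℚ) :* (a :* b)) :* (con 0ℚ :* y) :+ (b :* b) :* con 0ℚ)) refl a b y
        where open +-*-Solver

    -- The constant part adds nothing to the energy and a nonnegative amount to the norm, so `g`
    -- itself attains the maximum.
    maxRayleighQuotient : ∀ m → m ℚ.* massℚ g ≡ energyℚ g → 0ℚ ℚ.≤ m →
      IsMaxRayleighQuotient G δΩ Space [ fromℚ m ]
    maxRayleighQuotient m mM≡E 0≤m = (gℝ , g-member , g≢0 , ¬vanishes , attained) , maximal
      where
      gℝ : Vector ℝ n
      gℝ x = fromℚ (g x)
      coordinates : Vector ℝ 2
      coordinates zero    = 0ℝ
      coordinates (suc _) = 1ℝ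
      g-member : Space gℝ
      g-member = coordinates , λ x → ≗⇒≈ λ k → expand (g x)
        where
        expand : ∀ y → y ≡ 0ℚ ℚ.* 1ℚ ℚ.+ (1ℚ ℚ.* y ℚ.+ 0ℚ)
        expand = solve 1 (λ y → y := con 0ℚ :* con 1ℚ :+ (con 1ℚ :* y :+ con 0ℚ)) refl
          where open +-*-Solver
      ¬vanishes : ¬ VanishesOn G δΩ gℝ
      ¬vanishes vanishes = gu≢gv (fromℚ-injective (≈-trans (vanishes u u∈) (≈-sym (vanishes v v∈))))
      g≢0 : ¬ gℝ ≋ 0ᵥ
      g≢0 g≋0 = ¬vanishes λ x _ → g≋0 x
      attained : fromℚ m * boundaryNorm² G δΩ gℝ ≈ energy G gℝ
      attained = ≗⇒≈ λ k → trans (cong (m ℚ.*_) (seq-mass gℝ k)) (trans mM≡E (sym (seq-energy gℝ k)))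
      quotient-bound : ∀ a b → energyℚ (λ x → a ℚ.* 1ℚ ℚ.+ (b ℚ.* g x ℚ.+ 0ℚ)) ℚ.≤
        m ℚ.* massℚ (λ x → a ℚ.* 1ℚ ℚ.+ (b ℚ.* g x ℚ.+ 0ℚ))
      quotient-bound a b = begin
        energyℚ (λ x → a ℚ.* 1ℚ ℚ.+ (b ℚ.* g x ℚ.+ 0ℚ))
          ≡⟨ energyℚ-affine a b ⟩
        sq b ℚ.* energyℚ g
          ≡⟨ cong (sq b ℚ.*_) mM≡E ⟨
        sq b ℚ.* (m ℚ.* massℚ g)
          ≤⟨ p≤p+q (sq b ℚ.* (m ℚ.* massℚ g)) (*-nonNeg 0≤m (*-nonNeg (sq-nonNeg a)
               (∑-nonNeg λ x → χ-nonNeg (x ∈? δΩ)))) ⟩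
        sq b ℚ.* (m ℚ.* massℚ g) ℚ.+ m ℚ.* (sq a ℚ.* boundarySize)
          ≡⟨ regroup (sq a) (sq b) m (massℚ g) boundarySize ⟩
        m ℚ.* (sq a ℚ.* boundarySize ℚ.+ sq b ℚ.* massℚ g)
          ≡⟨ cong (m ℚ.*_) (massℚ-affine a b) ⟨
        m ℚ.* massℚ (λ x → a ℚ.* 1ℚ ℚ.+ (b ℚ.* g x ℚ.+ 0ℚ)) ∎
        where
        open ℚ.≤-Reasoning
        regroup : ∀ a b m M N → b ℚ.* (m ℚ.* M) ℚ.+ m ℚ.* (a ℚ.* N) ≡ m ℚ.* (a ℚ.* N ℚ.+ b ℚ.* M)
        regroup = solve 5 (λ a b m M N → b :* (m :* M) :+ m :* (a :* N) := m :* (a :* N :+ b :* M)) refl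
          where open +-*-Solver
      maximal : ∀ f r → Space f → ¬ (f ≋ 0ᵥ) → IsRayleighQuotient G δΩ f r → r ≤∞ [ fromℚ m ]
      maximal f ⊤⁺ member f≢0 vanishes = contradiction (vanishing-member member vanishes) f≢0
      maximal f [ r ] (c , f≋) _ (¬vanishes , rM≈E) = [ rayleigh≤ {combination c basis} {r} {m}
        (λ k → quotient-bound (seq (c zero) k) (seq (c (suc zero)) k))
        (λ vanishes → ¬vanishes λ x x∈ → ≈-trans (f≋ x) (vanishes x x∈))
        (≈-trans (*-cong (≈-refl {r}) (mass-cong (λ x → ≈-sym (f≋ x)))) (≈-trans rM≈E (energy-cong f≋))) ]

-- Decidability under double negation, and the final estimate

-- Double negation commutes with universal quantifiers over a finite type, so excluded middle may be
-- assumed for all triples at once.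
¬¬-decidable : ∀ {n} (P : Fin n → Fin n → Fin n → Set) → ¬ ¬ (∀ x y z → Dec (P x y z))
¬¬-decidable P = ∀-¬¬ λ x → ∀-¬¬ λ y → ∀-¬¬ λ z → ¬¬-excluded-middle
  where
  ∀-¬¬ : ∀ {n} {Q : Fin n → Set} → (∀ i → ¬ ¬ Q i) → ¬ ¬ (∀ i → Q i)
  ∀-¬¬ = Fin.sequence (RawMonad.rawApplicative ¬¬-Monad)

module _ {n} (G : Graph n) where
  open Graph G

  -- Well-founded descent: if no walk were shortest, each could be replaced by a shorter one.
  ¬¬distance : ∀ {u v} → Star _~_ u v → ¬ ¬ ∃ (IsDistance G u v)
  ¬¬distance {u} {v} p none = descend p (<-wellFounded (walkLength G p))
    where
    descend : ∀ (q : Star _~_ u v) → Acc ℕ._<_ (walkLength G q) → ⊥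
    descend q (acc rec) = none (walkLength G q , (q , refl) ,
      λ r → ℕ.≮⇒≥ λ r<q → descend r (rec r<q))

  -- With L = 0 every boundary vertex is at distance 0 from `u`, so the boundary would be a
  -- singleton.
  boundaryDiameter-nonZero : ∀ {δΩ L} → Connected G → 2 ℕ.≤ ∣ δΩ ∣ →
    IsBoundaryDiameter G δΩ L → NonZero L
  boundaryDiameter-nonZero {L = suc _} _ _ _ = _
  boundaryDiameter-nonZero {δΩ} {zero} connected 2≤∣δΩ∣ ((u , _ , u∈ , _) , max) =
    contradiction (ℕ.≤-trans 2≤∣δΩ∣ (subst (∣ δΩ ∣ ℕ.≤_) (∣⁅x⁆∣≡1 u) (p⊆q⇒∣p∣≤∣q∣ only-u)))
      (ℕ.n≮n 1)
    where
    no-edges : ∀ {v} (p : Star _~_ u v) → walkLength G p ℕ.≤ 0 → u ≡ v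
    no-edges ε _ = refl
    only-u : ∀ {v} → v ∈ δΩ → v ∈ ⁅ u ⁆
    only-u {v} v∈ = subst (_∈ ⁅ u ⁆)
      (decidable-stable (u ≟ v) λ u≢v → ¬¬distance (connected u v) λ (d , dist) →
        u≢v (no-edges (proj₁ (proj₁ dist))
          (subst (ℕ._≤ 0) (sym (proj₂ (proj₁ dist))) (max u v d u∈ v∈ dist))))
      (x∈⁅x⁆ u)

  eigenvalue-bound : ∀ (δΩ : Subset n) {B} → (∀ H → IsBlock G H → Complete G H) →
    (∀ H → IsBlock G H → ∣ Subgraph.vertices H ∣ ℕ.≤ B) →
    (∀ x u v → Dec (Separation.Joined G x u v)) →
    ∀ {u v} → u ∈ δΩ → v ∈ δΩ → (p : Star _~_ u v) →
    (∀ (q : Star _~_ u v) → walkLength G p ℕ.≤ walkLength G q) →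
    .{{_ : NonZero (walkLength G p)}} →
    ∀ {λ₂} → IsSteklovEigenvalue G δΩ 2 λ₂ → λ₂ ≤ fromℚ (+ B / walkLength G p)
  eigenvalue-bound δΩ {B} complete bound joined? {u} {v} u∈ v∈ p shortest {λ₂} (_ , least) =
    ≤-trans-fromℚ
      ([≤]-injective (least Space [ fromℚ m ] space-subspace space-dimension
        (maxRayleighQuotient m mM≡E 0≤m)))
      m≤q
    where
    open Dirichlet G
    open Potential G complete joined?
    open ℚ.≤-Reasoning
    L = walkLength G p
    induced = shortest-induced p shortest
    h = potential p

    N≢0 : boundarySize G δΩ ≢ 0ℚ
    N≢0 eq = ℚ.<-irrefl refl (ℚ.<-≤-trans (ℚ.positive⁻¹ 1ℚ) (subst₂ ℚ._≤_ (χ-yes (u ∈? δΩ) u∈) eq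
      (term≤∑ {f = λ x → χ (x ∈? δΩ)} (λ x → χ-nonNeg (x ∈? δΩ)) u)))

    c = proj₁ (centre G δΩ N≢0 h)
    g : Fin n → ℚ
    g x = h x ℚ.+ c

    rise : g v ℚ.- g u ≡ ι L ℚ.* ι 2
    rise = trans (cancel (h v) (h u) c) (potential-rise p induced)
      where
      cancel : ∀ a b c → (a ℚ.+ c) ℚ.- (b ℚ.+ c) ≡ a ℚ.- b
      cancel = solve 3 (λ a b c → (a :+ c) :- (b :+ c) := a :- b) refl
        where open +-*-Solver

    0<2L : 0ℚ ℚ.< ι L ℚ.* ι 2
    0<2L = *-pos (ι-pos L) (ι-pos 2)

    gu≢gv : g u ≢ g v
    gu≢gv eq = ℚ.<-irrefl (trans (sym (ℚ.+-inverseʳ (g u))) (trans (cong (λ t → t ℚ.- g u) eq) rise)) 0<2L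

    u≢v : u ≢ v
    u≢v refl = gu≢gv refl

    open TestSpace G δΩ g (proj₂ (centre G δΩ N≢0 h)) u∈ v∈ gu≢gv

    M = massℚ G δΩ g
    E = energyℚ g
    q = + B / L

    4L²≤M+M : sq (ι L ℚ.* ι 2) ℚ.≤ M ℚ.+ M
    4L²≤M+M = subst (λ t → sq t ℚ.≤ M ℚ.+ M) rise (sq-difference≤massℚ G δΩ g u∈ v∈ u≢v)

    0<M : 0ℚ ℚ.< M
    0<M = ℚ.≰⇒> λ M≤0 → ℚ.<-irrefl refl (begin-strict
      0ℚ                   <⟨ *-pos 0<2L 0<2L ⟩
      sq (ι L ℚ.* ι 2)     ≤⟨ 4L²≤M+M ⟩
      M ℚ.+ M              ≤⟨ ℚ.+-mono-≤ {M} {0ℚ} {M} {0ℚ} M≤0 M≤0 ⟩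
      0ℚ                   ∎)

    instance
      M-positive : ℚ.Positive M
      M-positive = ℚ.positive 0<M
      M-nonZero : ℚ.NonZero M
      M-nonZero = ℚ.pos⇒nonZero M
      1/M-positive : ℚ.Positive (ℚ.1/ M)
      1/M-positive = ℚ.1/pos⇒pos M

    m = E ℚ.* ℚ.1/ M

    mM≡E : m ℚ.* M ≡ E
    mM≡E = trans (ℚ.*-assoc E (ℚ.1/ M) M) (trans (cong (E ℚ.*_) (ℚ.*-inverseˡ M)) (ℚ.*-identityʳ E))

    0≤m : 0ℚ ℚ.≤ m
    0≤m = *-nonNeg (energyℚ-nonNeg g) (ℚ.<⇒≤ (ℚ.positive⁻¹ (ℚ.1/ M)))

    0≤q : 0ℚ ℚ.≤ q
    0≤q = ℚ.*-cancelʳ-≤-pos (ι L) {{ℚ.positive (ι-pos L)}}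
      (subst₂ ℚ._≤_ (sym (ℚ.*-zeroˡ (ι L))) (sym (/-*-cancel B L)) (ι-nonNeg B))

    m≤q : m ℚ.≤ q
    -- Both sides are doubled: 2E ≤ 4LB = q(2L)² ≤ 2qM, where qL = B.
    m≤q = ℚ.*-cancelʳ-≤-pos M (subst (ℚ._≤ q ℚ.* M) (sym mM≡E) (halve-≤ (begin
      E ℚ.+ E                               ≡⟨ cong₂ ℚ._+_ (energyℚ-shift G δΩ h c) (energyℚ-shift G δΩ h c) ⟩
      energyℚ h ℚ.+ energyℚ h               ≤⟨ energyℚ+energyℚ≤dirichlet h ⟩
      dirichlet h                           ≤⟨ dirichlet-potential bound p induced ⟩
      ι L ℚ.* (ι B ℚ.* ι 4)                 ≡⟨ cong (λ t → ι L ℚ.* (t ℚ.* ι 4)) (/-*-cancel B L) ⟨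
      ι L ℚ.* ((q ℚ.* ι L) ℚ.* ι 4)         ≡⟨ complete-square (ι L) q ⟩
      q ℚ.* sq (ι L ℚ.* ι 2)                ≤⟨ ℚ.*-monoˡ-≤-nonNeg q {{ℚ.nonNegative 0≤q}} 4L²≤M+M ⟩
      q ℚ.* (M ℚ.+ M)                       ≡⟨ ℚ.*-distribˡ-+ q M M ⟩
      q ℚ.* M ℚ.+ q ℚ.* M                   ∎)))
      where
      complete-square : ∀ l q → l ℚ.* ((q ℚ.* l) ℚ.* ι 4) ≡ q ℚ.* sq (l ℚ.* ι 2)
      complete-square = solve 2 (λ l q → l :* ((q :* l) :* con (ι 4)) :=
        q :* ((l :* con (ι 2)) :* (l :* con (ι 2)))) refl
        where open +-*-Solver

theorem1p4 : ∀ {n : ℕ} (G : Graph n) (δΩ : Subset n) →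
    IsBlockGraph G →
    2 ℕ.≤ ∣ δΩ ∣ →
    ∀ (L B : ℕ) → IsBoundaryDiameter G δΩ L → IsMaxBlockSize G B →
    ∀ (λ₂ : ℝ) → IsSteklovEigenvalue G δΩ 2 λ₂ →
    Σ[ L≢0 ∈ NonZero L ] λ₂ ≤ fromℚ ((+ B / L) {{L≢0}})
theorem1p4 G δΩ (connected , complete) 2≤∣δΩ∣ L B
  diameter@((u , v , u∈ , v∈ , (p , refl) , shortest) , _) (_ , bound) λ₂ eigenvalue =
  L≢0 , ¬exceeds⇒≤ λ exceeds → ¬¬-decidable (Separation.Joined G) λ joined? →
    ≤⇒¬exceeds (eigenvalue-bound G δΩ complete bound joined? u∈ v∈ p shortest {{L≢0}} eigenvalue) exceeds
  where L≢0 = boundaryDiameter-nonZero G connected 2≤∣δΩ∣ diameter
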